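{- Let ${\cal SD}$ be a dynamic dictionary that can be built in linear time and that supports $search$, $insert$ and $delete$ in $O(\log c)$ time when containing $c$ elements. For the dynamic Binning Learned Dictionary $D_k$ built from ${\cal SD}$ (as described in the context), holding $n$ elements, the following hold. The worst-case cost of $search$, $insert$ and $delete$ is $O\!\left(\log\min\left(n,\frac{n}{k}\Delta_{\max}\right)\right)$, where $\Delta_{\max}$ is the maximum gap ratio achieved over the lifetime of the structure; an analogous bound (with $\log\log$ in place of $\log$) holds when ${\cal SD}$ supports these operations in $O(\log\log c)$ time. The rebuilding of the data structure takes an amortized cost per element of $O\!\left(\log\frac{n}{k}\Delta_{\max}\right)$ time. When $\Delta_{\max}$ is known a priori, the total cost of rebuilding over the lifetime of the structure is linear in the number of elements in the data structure.
   Context: A dynamic sorted set dictionary over a set $A$ of integers from a totally ordered universe $U$ supports $search(x)$ (is $x\in A$), $insert(x)$ for $x\notin A$ and $delete(x)$ for $x\in A$. The gap ratio of a set $A=\{A[1]<\dots<A[n]\}$ is $\Delta=G_{\max}/G_{\min}$, the ratio of the maximum to the minimum distance between consecutive elements. Dynamic Binning structure $D_k$: at (re)build time let $L=A[n]-A[1]$ and let $\hat\Delta$ be the current gap-ratio estimate (initially the gap ratio of the initial set). The range $[A[1]-L\hat\Delta,\,A[n]+L\hat\Delta]$ is subdivided into $k$ consecutive bins each of size $\frac{(2\hat\Delta+1)L}{k}$; the elements of each bin are stored in a separate copy of ${\cal SD}$, with an array of $k$ pointers to these copies, and an operation on $x$ is directed to the bin containing $x$ (computed arithmetically in $O(1)$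 time). The structure is valid as long as the current gap ratio $\Delta$ satisfies $\Delta\le\hat\Delta$. It is rebuilt when $n/2$ updates have occurred since the last rebuild, or when the gap ratio exceeds $\hat\Delta$; in the latter case it is rebuilt with $\hat\Delta=\max(\Delta_{new},2\hat\Delta_{old})$, where $\Delta_{new}$ is the gap ratio of the current data and $\hat\Delta_{old}$ is the estimate of the last rebuild.
   Formalization: The formal statement adds that the number of bins satisfies k ≤ κ·n throughout the lifetime (κ an arbitrary constant on which the O-constants may depend); without it the claims fail, e.g. n = 2 with k unbounded makes one build cost at least k. "Number of elements" counts all elements ever stored. -}

module Defs where

open import Data.Bool.Base using (Bool; true; false; if_then_else_)
open import Data.Fin.Base using (Fin; fromℕ<)
import Data.Fin.Properties as Fin
open import Data.Integer.Base as ℤ using (ℤ; +_; 0ℤ)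
import Data.Integer.Properties as ℤ
open import Data.List.Base using (List; []; _∷_; _++_; head; last; length; map; foldr; filter)
open import Data.List.Extrema.Nat using (max; min)
open import Data.List.Membership.Propositional using (_∈_; _∉_)
open import Data.List.Relation.Unary.All using (All)
open import Data.List.Relation.Unary.Linked using (Linked)
import Data.List.Sort.InsertionSort.Base as InsertionSort
open import Data.Maybe.Base using (Maybe; just; nothing; fromMaybe)
import Data.Maybe.Properties as Maybe
open import Data.Nat.Base as ℕ using (ℕ; suc; _+_; _*_; _≤_; NonZero)
import Data.Nat.Properties as ℕ
open import Data.Nat.Logarithm using (⌊log₂_⌋)
open import Data.Product.Base using (∃-syntax; _×_)
open import Data.Rational.Base as ℚ using (ℚ; 0ℚ; 1ℚ; floor; ceiling)
import Data.Rational.Properties as ℚ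
open import Data.Unit.Base using (⊤)
open import Data.Vec.Base as Vec using (Vec; tabulate; lookup; updateAt)
open import Function.Base using (_∘_)
open import Function.Bundles using (_⇔_)
open import Relation.Binary.PropositionalEquality.Core using (_≡_)
open import Relation.Nullary.Decidable.Core using (does; yes; no)
open import Relation.Nullary.Decidable using (¬?)

------------------------------------------------------------------------
-- Asymptotic conventions

-- 1 + ⌊log₂ c⌋ is Θ(1 + log c): a bound O(log c) is read as O(1 + log c), so
-- that it still allows constant time when c ≤ 1.
lg : ℕ → ℕ
lg c = suc ⌊log₂ c ⌋

lglg : ℕ → ℕ
lglg = lg ∘ lg

-- Rounding the argument up makes every argument in (0, 1] contribute log 1 = 0.
_at_ : (ℕ → ℕ) → ℚ → ℕ
f at r = f ℤ.∣ ceiling r ∣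

------------------------------------------------------------------------
-- Rationals

-- Total division with the junk value p ÷₀ 0 = 0.
infixl 7 _÷₀_
_÷₀_ : ℚ → ℚ → ℚ
p ÷₀ q with q ℚ.≟ 0ℚ
... | yes _   = 0ℚ
... | no  q≢0 = ℚ._÷_ p q {{ℚ.≢-nonZero q≢0}}

fromℤ : ℤ → ℚ
fromℤ i = i ℚ./ 1

fromℕ : ℕ → ℚ
fromℕ n = fromℤ (+ n)

2ℚ : ℚ
2ℚ = fromℕ 2

------------------------------------------------------------------------
-- Finite sets of integers A[1] < … < A[n], as strictly increasing lists

Increasing : List ℤ → Set
Increasing = Linked ℤ._<_

add : ℤ → List ℤ → List ℤ
add = InsertionSort.insert ℤ.≤-decTotalOrder

remove : ℤ → List ℤ → List ℤ
remove x = filter (λ y → ¬? (y ℤ.≟ x))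

gaps : List ℤ → List ℕ
gaps []           = []
gaps (x ∷ [])     = []
gaps (x ∷ y ∷ xs) = ℤ.∣ y ℤ.- x ∣ ∷ gaps (y ∷ xs)

maxOverMin : List ℕ → ℚ
maxOverMin []       = 0ℚ
maxOverMin (g ∷ gs) = fromℕ (max g gs) ÷₀ fromℕ (min g gs)

-- Meaningful for at least two elements; the junk value is 0 otherwise.
gapRatio : List ℤ → ℚ
gapRatio A = maxOverMin (gaps A)

-- A[1] and A[n] (junk value 0 on the empty set).
first : List ℤ → ℤ
first A = fromMaybe 0ℤ (head A)

final : List ℤ → ℤ
final A = fromMaybe 0ℤ (last A)

------------------------------------------------------------------------
-- Dictionaries with explicit running times

record Dictionary : Set₁ where
  field
    State    : Set
    contents : State → List ℤ

    build  : List ℤ → State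
    search : ℤ → State → Bool
    insert : ℤ → State → State
    delete : ℤ → State → State

    buildCost  : List ℤ → ℕ
    searchCost : ℤ → State → ℕ
    insertCost : ℤ → State → ℕ
    deleteCost : ℤ → State → ℕ

    contents-increasing : ∀ s → Increasing (contents s)
    build-correct  : ∀ {xs} → Increasing xs → contents (build xs) ≡ xs
    search-correct : ∀ x s → search x s ≡ true ⇔ x ∈ contents s
    insert-correct : ∀ {x} s → x ∉ contents s → contents (insert x s) ≡ add x (contents s)
    delete-correct : ∀ {x} s → x ∈ contents s → contents (delete x s) ≡ remove x (contents s)

  size : State → ℕ
  size s = length (contents s)

LinearBuild : Dictionary → Set
LinearBuild SD = ∃[ a ] (∀ {xs} → Increasing xs → buildCost xs ≤ a * suc (length xs))
  where open Dictionary SD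

OperationsIn : (ℕ → ℕ) → Dictionary → Set
OperationsIn f SD = ∃[ a ] (∀ x s →
    (searchCost x s ≤ a * f (size s))
  × (x ∉ contents s → insertCost x s ≤ a * f (size s))
  × (x ∈ contents s → deleteCost x s ≤ a * f (size s)))
  where open Dictionary SD

------------------------------------------------------------------------
-- Operation sequences and their effect on the represented set

data Op : Set where
  search insert delete : ℤ → Op

Allowed : Op → List ℤ → Set
Allowed (search x) A = ⊤
Allowed (insert x) A = x ∉ A
Allowed (delete x) A = x ∈ A

apply : Op → List ℤ → List ℤ
apply (search x) A = A
apply (insert x) A = add x A
apply (delete x) A = remove x A

applyAll : List Op → List ℤ → List ℤ
applyAll []         A = A
applyAll (op ∷ ops) A = applyAll ops (apply op A)

AllAllowed : List Op → List ℤ → Set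
AllAllowed []         A = ⊤
AllAllowed (op ∷ ops) A = Allowed op A × AllAllowed ops (apply op A)

-- All sets held during the sequence, the initial and the last one included.
history : List Op → List ℤ → List (List ℤ)
history []         A = A ∷ []
history (op ∷ ops) A = A ∷ history ops (apply op A)

Δmax : List Op → List ℤ → ℚ
Δmax ops A = foldr ℚ._⊔_ 0ℚ (map gapRatio (history ops A))

-- Number of elements ever stored: the initial ones and one for each insertion.
elementsEver : List Op → List ℤ → ℕ
elementsEver []               A = length A
elementsEver (insert x ∷ ops) A = suc (elementsEver ops A)
elementsEver (search x ∷ ops) A = elementsEver ops A
elementsEver (delete x ∷ ops) A = elementsEver ops A

-- Gap ratios are defined throughout (n ≥ 2), and the number of bins is O(n)
-- with constant κ.
record Lifetime (κ k : ℕ) (ops : List Op) (A : List ℤ) : Set where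
  field
    increasing : Increasing A
    allowed    : AllAllowed ops A
    gapped     : All (λ B → 2 ≤ length B) (history ops A)
    binsO[n]   : All (λ B → k ≤ κ * length B) (history ops A)

------------------------------------------------------------------------
-- Subdivision of [A[1] - LΔ̂ , A[n] + LΔ̂] into k bins

module Subdivision (k : ℕ) .{{_ : NonZero k}} (Δ̂ : ℚ) (A : List ℤ) where

  L lower upper binSize : ℚ
  L       = fromℤ (final A ℤ.- first A)
  lower   = fromℤ (first A) ℚ.- L ℚ.* Δ̂
  upper   = fromℤ (final A) ℚ.+ L ℚ.* Δ̂
  binSize = (2ℚ ℚ.* Δ̂ ℚ.+ 1ℚ) ℚ.* L ÷₀ fromℕ k

  -- Bins are half-open [lower + i·binSize , lower + (i+1)·binSize), except that
  -- the last one also contains the point `upper`; hence the minimum with k - 1.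
  index : ℤ → ℕ
  index x = ℤ.∣ floor ((fromℤ x ℚ.- lower) ÷₀ binSize) ∣ ℕ.⊓ ℕ.pred k

  index<k : ∀ x → index x ℕ.< k
  index<k x = ℕ.<-≤-trans (ℕ.s≤s (ℕ.m⊓n≤n _ (ℕ.pred k))) (ℕ.≤-reflexive (ℕ.suc-pred k))

  locate : ℤ → Maybe (Fin k)
  locate x with lower ℚ.≤? fromℤ x | fromℤ x ℚ.≤? upper
  ... | yes _ | yes _ = just (fromℕ< (index<k x))
  ... | _     | _     = nothing

  binElements : Fin k → List ℤ
  binElements i = filter (λ x → Maybe.≡-dec Fin._≟_ (locate x) (just i)) A

------------------------------------------------------------------------
-- The dynamic binning dictionary D_k over SD

-- Constant-time primitives outside SD: finding the bin of an operation's
-- argument, and the work of a rebuild per element and per pointer.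
record Overhead : Set where
  field
    perOperation perElement perBin : ℕ

module Binning (SD : Dictionary) (t : Overhead) (k : ℕ) .{{_ : NonZero k}} where

  private module SD = Dictionary SD
  open Overhead t

  record Structure : Set where
    field
      current  : List ℤ        -- the represented set
      snapshot : List ℤ        -- the represented set at the last (re)build
      Δ̂        : ℚ
      updates  : ℕ             -- since the last (re)build
      bins     : Vec SD.State k

    open Subdivision k Δ̂ snapshot public using (locate)

  open Structure

  buildWith : ℚ → List ℤ → Structure
  buildWith Δ̂ A = record
    { current  = A
    ; snapshot = A
    ; Δ̂        = Δ̂
    ; updates  = 0
    ; bins     = tabulate (λ i → SD.build (binElements i))
    }
    where open Subdivision k Δ̂ A

  buildWithCost : ℚ → List ℤ → ℕ
  buildWithCost Δ̂ A = perElement * length A + perBin * k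
                    + Vec.sum (tabulate (λ i → SD.buildCost (binElements i)))
    where open Subdivision k Δ̂ A

  member : ℤ → Structure → Bool
  member x D with locate D x
  ... | just i  = SD.search x (lookup (bins D) i)
  ... | nothing = false

  inBin : ℤ → (SD.State → SD.State) → Structure → Vec SD.State k
  inBin x f D with locate D x
  ... | just i  = updateAt (bins D) i f
  ... | nothing = bins D

  inBinCost : ℤ → (SD.State → ℕ) → Structure → ℕ
  inBinCost x cost D with locate D x
  ... | just i  = cost (lookup (bins D) i)
  ... | nothing = 0

  -- An operation before any rebuild it may trigger.
  perform : Op → Structure → Structure
  perform (search x) D = D
  perform (insert x) D = record D
    { current = add x (current D)
    ; updates = suc (updates D)
    ; bins    = inBin x (SD.insert x) D
    }
  perform (delete x) D = record D
    { current = remove x (current D)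
    ; updates = suc (updates D)
    ; bins    = inBin x (SD.delete x) D
    }

  operationCost : Op → Structure → ℕ
  operationCost (search x) D = perOperation + inBinCost x (SD.searchCost x) D
  operationCost (insert x) D = perOperation + inBinCost x (SD.insertCost x) D
  operationCost (delete x) D = perOperation + inBinCost x (SD.deleteCost x) D

  -- The estimate to rebuild with, if a rebuild is due.
  rebuildDue : Structure → Maybe ℚ
  rebuildDue D =
    if does (Δ̂ D ℚ.<? gapRatio (current D))
    then just (gapRatio (current D) ℚ.⊔ 2ℚ ℚ.* Δ̂ D)
    else if does (length (snapshot D) ℕ.≤? 2 * updates D)
    then just (Δ̂ D)
    else nothing

  maintain : Structure → Structure
  maintain D with rebuildDue D
  ... | just Δ̂′ = buildWith Δ̂′ (current D)
  ... | nothing = D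

  maintainCost : Structure → ℕ
  maintainCost D with rebuildDue D
  ... | just Δ̂′ = buildWithCost Δ̂′ (current D)
  ... | nothing = 0

  step : Op → Structure → Structure
  step (search x) D = D
  step (insert x) D = maintain (perform (insert x) D)
  step (delete x) D = maintain (perform (delete x) D)

  stepRebuildCost : Op → Structure → ℕ
  stepRebuildCost (search x) D = 0
  stepRebuildCost (insert x) D = maintainCost (perform (insert x) D)
  stepRebuildCost (delete x) D = maintainCost (perform (delete x) D)

  run : List Op → Structure → Structure
  run []         D = D
  run (op ∷ ops) D = run ops (step op D)

  runRebuildCost : List Op → Structure → ℕ
  runRebuildCost []         D = 0
  runRebuildCost (op ∷ ops) D = stepRebuildCost op D + runRebuildCost ops (step op D)

  -- All (re)builds, the initial one included, from initial estimate Δ̂₀.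
  totalRebuildCost : ℚ → List Op → List ℤ → ℕ
  totalRebuildCost Δ̂₀ ops A = buildWithCost Δ̂₀ A + runRebuildCost ops (buildWith Δ̂₀ A)

------------------------------------------------------------------------
-- The bounds; each constant C depends on SD, the overheads and κ only

module _ (SD : Dictionary) (t : Overhead) (κ : ℕ) where

  OperationBound : (ℕ → ℕ) → Set
  OperationBound f =
    ∃[ C ] (∀ (k : ℕ) .{{_ : NonZero k}} (A : List ℤ) (before : List Op) (op : Op) (after : List Op) →
      let open Binning SD t k
          ops = before ++ op ∷ after
          n   = length (applyAll before A)
      in Lifetime κ k ops A →
         operationCost op (run before (buildWith (gapRatio A) A))
           ≤ C * (f at (fromℕ n ℚ.⊓ (fromℕ n ÷₀ fromℕ k ℚ.* Δmax ops A))))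

  AmortizedRebuildBound : Set
  AmortizedRebuildBound =
    ∃[ C ] (∀ (k : ℕ) .{{_ : NonZero k}} (A : List ℤ) (ops : List Op) →
      let open Binning SD t k in
      Lifetime κ k ops A →
      ∀ {B} → B ∈ history ops A →
      let n = length B in
      totalRebuildCost (gapRatio A) ops A
        ≤ elementsEver ops A * (C * (lg at (fromℕ n ÷₀ fromℕ k ℚ.* Δmax ops A))))

  -- Knowing Δmax a priori means starting with it as the estimate.
  KnownRatioRebuildBound : Set
  KnownRatioRebuildBound =
    ∃[ C ] (∀ (k : ℕ) .{{_ : NonZero k}} (A : List ℤ) (ops : List Op) →
      let open Binning SD t k in
      Lifetime κ k ops A →
      totalRebuildCost (Δmax ops A) ops A ≤ C * elementsEver ops A)

{-# OPTIONS --safe #-}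

-- Write n for the current size, Δ for Δmax, S for the set at the last rebuild, and
-- g for the smallest current gap. The estimate satisfies Δ̂ ≤ 2Δ. Fewer than |S| / 2
-- updates have occurred since the rebuild, so more than half of S survives; the
-- survivors are spread out by the gaps of S, but lie within the span of the current
-- set, and this gives that S spans at most 4 n Δ² g. A bin is therefore of size
-- O(n Δ³ g / k) and contains O(n Δ³ / k) elements. As k ≤ κ n, this is polynomial in
-- (n / k) Δ, hence of the same logarithm up to a constant.
--
-- A rebuild triggered by n / 2 updates is paid by these updates. One triggered by the
-- gap ratio doubles Δ̂ while Δ̂ < Δ, which happens O(log Δ) times, and never if the
-- initial estimate is Δ.
module Submission where

open import Defs
open import Data.Bool.Base using (if_then_else_)
open import Data.Fin.Base as Fin using (Fin; toℕ)
import Data.Fin.Properties as Fin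
open import Data.Integer.Base as ℤ using (ℤ; +_; 0ℤ; 1ℤ)
import Data.Integer.DivMod as ℤ
import Data.Integer.Properties as ℤ
import Data.Integer.Solver as ℤSolver
open import Data.List.Base using (List; []; _∷_; _++_; length; map; foldr; filter)
open import Data.List.Extrema.Nat using (max; min; min≤⊤; min≤xs; ⊥≤max; xs≤max; v≤min⁺)
open import Data.List.Membership.Propositional using (_∈_; _∉_)
open import Data.List.Membership.Propositional.Properties using (∈-filter⁺; ∈-filter⁻)
import Data.List.Properties as List
open import Data.List.Relation.Binary.Permutation.Propositional using (_↭_; ↭-sym)
open import Data.List.Relation.Binary.Permutation.Propositional.Properties using (∈-resp-↭; ↭-length)
open import Data.List.Relation.Binary.Subset.Propositional using (_⊆_)
open import Data.List.Relation.Unary.All as All using (All; []; _∷_)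
open import Data.List.Relation.Unary.Any as Any using (here; there)
open import Data.List.Relation.Unary.Linked as Linked using ([]; [-]; _∷_)
import Data.List.Relation.Unary.Linked.Properties as Linked
import Data.List.Sort.InsertionSort.Properties as InsertionSort
open import Data.Maybe.Base using (Maybe; just; nothing)
import Data.Maybe.Properties as Maybe
open import Data.Nat.Base as ℕ using (ℕ; zero; suc; _+_; _*_; _^_; _≤_; _<_; NonZero; s≤s; z≤n)
import Data.Nat.Coprimality as Coprime
open import Data.Nat.Induction using (<-rec)
open import Data.Nat.Logarithm using (⌊log₂_⌋; ⌊log₂⌋-mono-≤; ⌊log₂⌊n/2⌋⌋≡⌊log₂n⌋∸1; ⌊log₂[2^n]⌋≡n)
import Data.Nat.Properties as ℕ
open import Data.Nat.Tactic.RingSolver using (solve-∀)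
open import Data.Product.Base using (∃-syntax; _×_; _,_; proj₁; proj₂)
open import Data.Rational.Base as ℚ using (ℚ; mkℚ; 0ℚ; 1ℚ; floor; ceiling)
import Data.Rational.Properties as ℚ
open import Algebra.Properties.Group ℚ.+-0-group using (⁻¹-involutive)
open import Data.Rational.Solver using (module +-*-Solver)
open import Data.Sum.Base using (_⊎_; inj₁; inj₂)
open import Data.Vec.Base as Vec using (tabulate; lookup)
import Data.Vec.Properties as Vec
open import Function.Base using (id; case_of_; _∘_)
open import Relation.Binary.PropositionalEquality
open import Relation.Nullary.Decidable using (¬?)
open import Relation.Nullary.Decidable.Core using (Dec; does; yes; no)
open import Relation.Nullary.Negation.Core using (contradiction)

-- Rational arithmetic

-- The obstacle is that two sets are in play. The bins are cut according to the snapshot, but how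
-- many elements fit into one depends on the smallest gap of the current set, and the two smallest
-- gaps are not directly comparable. The survivors of the snapshot mediate between them: they are at
-- least as sparse as the snapshot, being a subset of it, and no wider than the current set. The
-- detour costs additional powers of the gap ratio, which only a logarithm can forgive; so the proof
-- aims at some polynomial bound on the occupancy of a bin and not at a sharp one. The counting
-- takes place in ℕ. With `N` the rounded value of (n / k) Δ, the ratio n / k is replaced by `N` and
-- Δ by `κ * N`; the inequalities on spans and lengths are then polynomial. Rationals remain in the
-- subdivision, in the estimate and in the translation to `N`.

i<j⇒0<j-i : ∀ {i j} → i ℤ.< j → 0ℤ ℤ.< j ℤ.- i
i<j⇒0<j-i {i} {j} i<j = subst (ℤ._< j ℤ.- i) (ℤ.+-inverseʳ i) (ℤ.+-monoˡ-< (ℤ.- i) i<j)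

-- Division by 1 normalises through a gcd and is stuck on a variable numerator. Rewriting to an
-- explicit fraction with denominator 1 lets order and arithmetic compute on integers.
fromℤ≡mkℚ : ∀ i → fromℤ i ≡ mkℚ i 0 (Coprime.sym (Coprime.1-coprimeTo ℤ.∣ i ∣))
fromℤ≡mkℚ i = ℚ.↥p/↧p≡p (mkℚ i 0 _)

fromℤ-mono-≤ : ∀ {i j} → i ℤ.≤ j → fromℤ i ℚ.≤ fromℤ j
fromℤ-mono-≤ {i} {j} i≤j rewrite fromℤ≡mkℚ i | fromℤ≡mkℚ j =
  ℚ.*≤* (ℤ.*-monoʳ-≤-nonNeg 1ℤ i≤j)

fromℤ-cancel-≤ : ∀ {i j} → fromℤ i ℚ.≤ fromℤ j → i ℤ.≤ j
fromℤ-cancel-≤ {i} {j} p rewrite fromℤ≡mkℚ i | fromℤ≡mkℚ j =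
  ℤ.*-cancelʳ-≤-pos i j 1ℤ (ℚ.drop-*≤* p)

fromℤ-mono-< : ∀ {i j} → i ℤ.< j → fromℤ i ℚ.< fromℤ j
fromℤ-mono-< {i} {j} i<j rewrite fromℤ≡mkℚ i | fromℤ≡mkℚ j =
  ℚ.*<* (ℤ.*-monoʳ-<-pos 1ℤ i<j)

fromℤ-+ : ∀ i j → fromℤ (i ℤ.+ j) ≡ fromℤ i ℚ.+ fromℤ j
fromℤ-+ i j rewrite fromℤ≡mkℚ i | fromℤ≡mkℚ j =
  cong fromℤ (sym (cong₂ ℤ._+_ (ℤ.*-identityʳ i) (ℤ.*-identityʳ j)))

fromℤ-* : ∀ i j → fromℤ (i ℤ.* j) ≡ fromℤ i ℚ.* fromℤ j
fromℤ-* i j rewrite fromℤ≡mkℚ i | fromℤ≡mkℚ j = refl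

fromℤ-neg : ∀ i → fromℤ (ℤ.- i) ≡ ℚ.- fromℤ i
fromℤ-neg (+ 0)      = refl
fromℤ-neg ℤ.+[1+ n ] = refl
fromℤ-neg ℤ.-[1+ n ] = sym (⁻¹-involutive (fromℤ ℤ.+[1+ n ]))

fromℤ-- : ∀ i j → fromℤ (i ℤ.- j) ≡ fromℤ i ℚ.- fromℤ j
fromℤ-- i j = trans (fromℤ-+ i (ℤ.- j)) (cong (fromℤ i ℚ.+_) (fromℤ-neg j))

fromℕ-mono-≤ : ∀ {m n} → m ≤ n → fromℕ m ℚ.≤ fromℕ n
fromℕ-mono-≤ m≤n = fromℤ-mono-≤ (ℤ.+≤+ m≤n)

fromℕ-cancel-≤ : ∀ {m n} → fromℕ m ℚ.≤ fromℕ n → m ≤ n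
fromℕ-cancel-≤ p = ℤ.drop‿+≤+ (fromℤ-cancel-≤ p)

fromℕ-* : ∀ m n → fromℕ (m * n) ≡ fromℕ m ℚ.* fromℕ n
fromℕ-* m n = trans (cong fromℤ (ℤ.pos-* m n)) (fromℤ-* (+ m) (+ n))

fromℕ-nonNeg : ∀ n → ℚ.NonNegative (fromℕ n)
fromℕ-nonNeg n = ℚ.nonNegative {fromℕ n} (fromℕ-mono-≤ {0} {n} z≤n)

fromℕ-pos : ∀ {n} → 0 < n → 0ℚ ℚ.< fromℕ n
fromℕ-pos {n} 0<n = fromℤ-mono-< {0ℤ} {+ n} (ℤ.+<+ 0<n)

-- The only place where `÷₀` is unfolded and its junk value excluded; everything later about
-- quotients is derived by multiplying out.
÷₀-* : ∀ p {q} → 0ℚ ℚ.< q → (p ÷₀ q) ℚ.* q ≡ p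
÷₀-* p {q} 0<q with q ℚ.≟ 0ℚ
... | yes q≡0 = contradiction (sym q≡0) (ℚ.<⇒≢ 0<q)
... | no  q≢0 = begin
  p ℚ.* (ℚ.1/ q) ℚ.* q    ≡⟨ ℚ.*-assoc p (ℚ.1/ q) q ⟩
  p ℚ.* ((ℚ.1/ q) ℚ.* q)  ≡⟨ cong (p ℚ.*_) (ℚ.*-inverseˡ q) ⟩
  p ℚ.* 1ℚ                ≡⟨ ℚ.*-identityʳ p ⟩
  p                       ∎
  where
  open ≡-Reasoning
  instance _ = ℚ.≢-nonZero q≢0

module _ {p q r : ℚ} (0<q : 0ℚ ℚ.< q) where
  private instance
    q>0 = ℚ.positive 0<q
    q≥0 = ℚ.pos⇒nonNeg q

  ≤÷₀⇒*≤ : r ℚ.≤ p ÷₀ q → r ℚ.* q ℚ.≤ p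
  ≤÷₀⇒*≤ r≤ = subst (r ℚ.* q ℚ.≤_) (÷₀-* p 0<q) (ℚ.*-monoʳ-≤-nonNeg q r≤)

  ÷₀≤⇒≤* : p ÷₀ q ℚ.≤ r → p ℚ.≤ r ℚ.* q
  ÷₀≤⇒≤* ≤r = subst (ℚ._≤ r ℚ.* q) (÷₀-* p 0<q) (ℚ.*-monoʳ-≤-nonNeg q ≤r)

  *≤⇒≤÷₀ : r ℚ.* q ℚ.≤ p → r ℚ.≤ p ÷₀ q
  *≤⇒≤÷₀ ≤p = ℚ.*-cancelʳ-≤-pos q (subst (r ℚ.* q ℚ.≤_) (sym (÷₀-* p 0<q)) ≤p)

  ≤*⇒÷₀≤ : p ℚ.≤ r ℚ.* q → p ÷₀ q ℚ.≤ r
  ≤*⇒÷₀≤ p≤ = ℚ.*-cancelʳ-≤-pos q (subst (ℚ._≤ r ℚ.* q) (sym (÷₀-* p 0<q)) p≤)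

*-pos : ∀ {p q} → 0ℚ ℚ.< p → 0ℚ ℚ.< q → 0ℚ ℚ.< p ℚ.* q
*-pos {p} {q} 0<p 0<q = ℚ.positive⁻¹ (p ℚ.* q)
  {{ℚ.pos*pos⇒pos p {{ℚ.positive 0<p}} q {{ℚ.positive 0<q}}}}

÷₀-pos : ∀ {p q} → 0ℚ ℚ.< p → 0ℚ ℚ.< q → 0ℚ ℚ.< p ÷₀ q
÷₀-pos {p} {q} 0<p 0<q = ℚ.*-cancelʳ-<-nonNeg q {{ℚ.nonNegative (ℚ.<⇒≤ 0<q)}} {0ℚ} {p ÷₀ q}
  (subst₂ ℚ._<_ (sym (ℚ.*-zeroˡ q)) (sym (÷₀-* p 0<q)) 0<p)

floor≤ : ∀ p → fromℤ (floor p) ℚ.≤ p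
floor≤ p@(mkℚ n d-1 _) rewrite fromℤ≡mkℚ (floor p) = ℚ.*≤* (ℤ.≤-trans
  (ℤ.[n/d]*d≤n n (+ suc d-1)) (ℤ.≤-reflexive (sym (ℤ.*-identityʳ n))))

<suc-floor : ∀ p → p ℚ.< fromℤ (ℤ.suc (floor p))
<suc-floor p@(mkℚ n d-1 _) rewrite fromℤ≡mkℚ (ℤ.suc (floor p)) = ℚ.*<* (begin-strict
  n ℤ.* 1ℤ                                ≡⟨ ℤ.*-identityʳ n ⟩
  n                                       <⟨ ℤ.n<s[n/ℕd]*d n (suc d-1) ⟩
  ℤ.suc (n ℤ./ℕ suc d-1) ℤ.* + suc d-1    ≡⟨ cong (λ z → ℤ.suc z ℤ.* + suc d-1) (ℤ.div-pos-is-/ℕ n (suc d-1)) ⟨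
  ℤ.suc (n ℤ./ + suc d-1) ℤ.* + suc d-1   ∎)
  where open ℤ.≤-Reasoning

floor-nonNeg : ∀ {p} → 0ℚ ℚ.≤ p → 0ℤ ℤ.≤ floor p
floor-nonNeg {mkℚ n d-1 _} 0≤p = ℤ.0≤n⇒0≤n/d n (+ suc d-1)
  (subst (0ℤ ℤ.≤_) (ℤ.*-identityʳ n) (ℚ.drop-*≤* 0≤p)) (ℤ.+≤+ z≤n)

≤ceiling : ∀ p → p ℚ.≤ fromℕ ℤ.∣ ceiling p ∣
-- Matching on the record constructor lets `ceiling p` unfold to a negated floor. The absolute value
-- comes from `_at_` and can only enlarge the bound.
≤ceiling p@record{} = ℚ.≤-trans
  (subst₂ ℚ._≤_ (⁻¹-involutive p) (sym (fromℤ-neg (floor (ℚ.- p)))) (ℚ.neg-antimono-≤ (floor≤ (ℚ.- p))))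
  (fromℤ-mono-≤ (i≤+∣i∣ (ceiling p)))
  where
  i≤+∣i∣ : ∀ i → i ℤ.≤ + ℤ.∣ i ∣
  i≤+∣i∣ (+ n)        = ℤ.≤-refl
  i≤+∣i∣ ℤ.-[1+ n ]   = ℤ.-≤+

-- Bins

private
  module Identities where
    open +-*-Solver

    range-length : ∀ a b l d →
      (b ℚ.+ l ℚ.* d) ℚ.- (a ℚ.- l ℚ.* d) ≡ (b ℚ.- a) ℚ.+ 2ℚ ℚ.* (l ℚ.* d)
    range-length = solve 4 (λ a b l d →
      (b :+ l :* d) :- (a :- l :* d) := (b :- a) :+ con 2ℚ :* (l :* d)) refl

    factor-length : ∀ l d → l ℚ.+ 2ℚ ℚ.* (l ℚ.* d) ≡ (2ℚ ℚ.* d ℚ.+ 1ℚ) ℚ.* l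
    factor-length = solve 2 (λ l d →
      l :+ con 2ℚ :* (l :* d) := (con 2ℚ :* d :+ con 1ℚ) :* l) refl

    shift-difference : ∀ y x l → y ℚ.- x ≡ (y ℚ.- l) ℚ.- (x ℚ.- l)
    shift-difference = solve 3 (λ y x l → y :- x := (y :- l) :- (x :- l)) refl

    consecutive-multiples : ∀ n b → (1ℚ ℚ.+ n) ℚ.* b ℚ.- n ℚ.* b ≡ b
    consecutive-multiples = solve 2 (λ n b → (con 1ℚ :+ n) :* b :- n :* b := b) refl

-- In the last bin the minimum may be attained by k - 1, and then the upper bound
-- comes from p ≤ k.
clamped-floor : ∀ {k p} .{{_ : NonZero k}} → 0ℚ ℚ.≤ p → p ℚ.≤ fromℕ k →
  let i = ℤ.∣ floor p ∣ ℕ.⊓ ℕ.pred k in (fromℕ i ℚ.≤ p) × (p ℚ.≤ fromℕ (suc i))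
clamped-floor {k} {p} 0≤p p≤k = ℚ.≤-trans
    (fromℕ-mono-≤ {ℤ.∣ floor p ∣ ℕ.⊓ ℕ.pred k} {ℤ.∣ floor p ∣} (ℕ.m⊓n≤m _ (ℕ.pred k)))
    (subst (λ i → fromℤ i ℚ.≤ p) (sym ∣floor∣) (floor≤ p))
  , p≤ (ℕ.⊓-sel ℤ.∣ floor p ∣ (ℕ.pred k))
  where
  ∣floor∣ : + ℤ.∣ floor p ∣ ≡ floor p
  ∣floor∣ = ℤ.0≤i⇒+∣i∣≡i (floor-nonNeg 0≤p)
  p≤ : ∀ {i} → i ≡ ℤ.∣ floor p ∣ ⊎ i ≡ ℕ.pred k → p ℚ.≤ fromℕ (suc i)
  p≤ (inj₁ refl) = ℚ.<⇒≤ (subst (λ i → p ℚ.< fromℤ (ℤ.suc i)) (sym ∣floor∣) (<suc-floor p))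
  p≤ (inj₂ refl) = subst (λ j → p ℚ.≤ fromℕ j) (sym (ℕ.suc-pred k)) p≤k

same-cell : ∀ {n b l x y} → n ℚ.* b ℚ.≤ x ℚ.- l → y ℚ.- l ℚ.≤ (1ℚ ℚ.+ n) ℚ.* b → y ℚ.- x ℚ.≤ b
same-cell {n} {b} {l} {x} {y} x≥ y≤ = begin
  y ℚ.- x                            ≡⟨ Identities.shift-difference y x l ⟩
  (y ℚ.- l) ℚ.- (x ℚ.- l)            ≤⟨ ℚ.+-mono-≤ y≤ (ℚ.neg-antimono-≤ x≥) ⟩
  (1ℚ ℚ.+ n) ℚ.* b ℚ.- n ℚ.* b       ≡⟨ Identities.consecutive-multiples n b ⟩
  b                                  ∎
  where open ℚ.≤-Reasoning

module BinDiameter (k : ℕ) .{{_ : NonZero k}} (Δ̂ : ℚ) (A : List ℤ)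
                   (0≤Δ̂ : 0ℚ ℚ.≤ Δ̂) (first<final : first A ℤ.< final A) where

  open Subdivision k Δ̂ A

  private
    0<k : 0ℚ ℚ.< fromℕ k
    0<k = fromℕ-pos (ℕ.>-nonZero⁻¹ k)

    0<L : 0ℚ ℚ.< L
    0<L = fromℤ-mono-< {0ℤ} (i<j⇒0<j-i first<final)

    0<2Δ̂+1 : 0ℚ ℚ.< 2ℚ ℚ.* Δ̂ ℚ.+ 1ℚ
    0<2Δ̂+1 = ℚ.<-≤-trans (ℚ.positive⁻¹ 1ℚ) (subst (ℚ._≤ 2ℚ ℚ.* Δ̂ ℚ.+ 1ℚ) (ℚ.+-identityˡ 1ℚ)
      (ℚ.+-monoˡ-≤ 1ℚ (subst (ℚ._≤ 2ℚ ℚ.* Δ̂) (ℚ.*-zeroʳ 2ℚ) (ℚ.*-monoˡ-≤-nonNeg 2ℚ 0≤Δ̂))))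

    0<binSize : 0ℚ ℚ.< binSize
    0<binSize = ÷₀-pos (*-pos 0<2Δ̂+1 0<L) 0<k

    binSize*k : binSize ℚ.* fromℕ k ≡ (2ℚ ℚ.* Δ̂ ℚ.+ 1ℚ) ℚ.* L
    binSize*k = ÷₀-* _ 0<k

    -- The `k` cells tile the range exactly, so that the position of a point up to `upper` is at
    -- most `k`, as `clamped-floor` requires.
    upper-lower : upper ℚ.- lower ≡ fromℕ k ℚ.* binSize
    upper-lower = begin
      upper ℚ.- lower
        ≡⟨ Identities.range-length (fromℤ (first A)) (fromℤ (final A)) L Δ̂ ⟩
      (fromℤ (final A) ℚ.- fromℤ (first A)) ℚ.+ 2ℚ ℚ.* (L ℚ.* Δ̂)
        ≡⟨ cong (ℚ._+ 2ℚ ℚ.* (L ℚ.* Δ̂)) (fromℤ-- (final A) (first A)) ⟨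
      L ℚ.+ 2ℚ ℚ.* (L ℚ.* Δ̂)
        ≡⟨ Identities.factor-length L Δ̂ ⟩
      (2ℚ ℚ.* Δ̂ ℚ.+ 1ℚ) ℚ.* L
        ≡⟨ binSize*k ⟨
      binSize ℚ.* fromℕ k
        ≡⟨ ℚ.*-comm binSize (fromℕ k) ⟩
      fromℕ k ℚ.* binSize
        ∎
      where open ≡-Reasoning

    position : ℤ → ℚ
    position x = (fromℤ x ℚ.- lower) ÷₀ binSize

    module _ x (lower≤x : lower ℚ.≤ fromℤ x) (x≤upper : fromℤ x ℚ.≤ upper) where

      0≤position : 0ℚ ℚ.≤ position x
      0≤position = *≤⇒≤÷₀ 0<binSize (subst (ℚ._≤ fromℤ x ℚ.- lower)
        (trans (ℚ.+-inverseʳ lower) (sym (ℚ.*-zeroˡ binSize)))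
        (ℚ.+-monoˡ-≤ (ℚ.- lower) lower≤x))

      position≤k : position x ℚ.≤ fromℕ k
      position≤k = ≤*⇒÷₀≤ 0<binSize (subst (fromℤ x ℚ.- lower ℚ.≤_) upper-lower
        (ℚ.+-monoˡ-≤ (ℚ.- lower) x≤upper))

    locate⁻ : ∀ {x i} → locate x ≡ just i →
      (fromℕ (toℕ i) ℚ.≤ position x) × (position x ℚ.≤ fromℕ (suc (toℕ i)))
    locate⁻ {x} eq with lower ℚ.≤? fromℤ x | fromℤ x ℚ.≤? upper
    locate⁻ {x} refl | yes l | yes u = subst
      (λ j → (fromℕ j ℚ.≤ position x) × (position x ℚ.≤ fromℕ (suc j)))
      (sym (Fin.toℕ-fromℕ< (index<k x)))
      (clamped-floor (0≤position x l u) (position≤k x l u))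
    locate⁻ () | yes _ | no _
    locate⁻ () | no _  | _

  -- The bin size is multiplied out by `k`, so that the inequality can later be read off in ℕ.
  locate-diameter : ∀ {x y i} → locate x ≡ just i → locate y ≡ just i →
    fromℤ (y ℤ.- x) ℚ.* fromℕ k ℚ.≤ (2ℚ ℚ.* Δ̂ ℚ.+ 1ℚ) ℚ.* L
  locate-diameter {x} {y} {i} x∈i y∈i = subst₂ (λ d r → d ℚ.* fromℕ k ℚ.≤ r)
    (sym (fromℤ-- y x)) binSize*k
    (ℚ.*-monoʳ-≤-nonNeg (fromℕ k) {{fromℕ-nonNeg k}} (same-cell {fromℕ (toℕ i)} {binSize} {lower} {fromℤ x} {fromℤ y}
      (≤÷₀⇒*≤ 0<binSize (proj₁ (locate⁻ {x} x∈i)))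
      (÷₀≤⇒≤* 0<binSize (subst (position y ℚ.≤_) (fromℤ-+ 1ℤ (+ toℕ i)) (proj₂ (locate⁻ {y} y∈i))))))

-- Logarithms

lg-mono : ∀ {m n} → m ≤ n → lg m ≤ lg n
lg-mono m≤n = s≤s (⌊log₂⌋-mono-≤ m≤n)

-- Strong induction, because the logarithm is known through halving: from h < 2 ^ l also 1 + h ≤ 2 ^
-- l, which covers the half that is rounded up.
n<2^lg : ∀ n → n < 2 ^ lg n
n<2^lg = <-rec _ go
  where
  go : ∀ n → (∀ {m} → m < n → m < 2 ^ lg m) → n < 2 ^ lg n
  go 0 _ = s≤s z≤n
  go 1 _ = s≤s (s≤s z≤n)
  go n@(suc (suc m)) ih = begin-strict
    n                            ≡⟨ ℕ.⌊n/2⌋+⌈n/2⌉≡n n ⟨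
    h + ℕ.⌈ n /2⌉                ≤⟨ ℕ.+-monoʳ-≤ h (s≤s (ℕ.⌊n/2⌋-mono (ℕ.n≤1+n (suc m)))) ⟩
    h + suc h                    <⟨ ℕ.+-mono-<-≤ h<2^log h<2^log ⟩
    2 ^ l + 2 ^ l                ≡⟨ cong (λ m → 2 ^ l + m) (ℕ.+-identityʳ (2 ^ l)) ⟨
    2 ^ lg n                     ∎
    where
    open ℕ.≤-Reasoning
    h = ℕ.⌊ n /2⌋
    l = ⌊log₂ n ⌋
    1≤l : 1 ≤ l
    1≤l = ⌊log₂⌋-mono-≤ {2} {n} (s≤s (s≤s z≤n))
    h<2^log : h < 2 ^ l
    h<2^log = subst (λ e → h < 2 ^ e)
      (trans (cong suc (⌊log₂⌊n/2⌋⌋≡⌊log₂n⌋∸1 n)) (ℕ.m+[n∸m]≡n 1≤l))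
      (ih (s≤s (s≤s (ℕ.⌊n/2⌋≤n m))))

-- Replacing `c` and `n` by powers of two turns the logarithm into an exponent linear in `lg n`; the
-- summand from `c` is absorbed since `lg n` is at least 1.
lg-polynomial : ∀ c e n → lg (c * n ^ e) ≤ suc (lg c + e) * lg n
lg-polynomial c e n = begin
  suc ⌊log₂ (c * n ^ e) ⌋               ≤⟨ s≤s (⌊log₂⌋-mono-≤ (ℕ.*-mono-≤ (ℕ.<⇒≤ (n<2^lg c)) (ℕ.^-monoˡ-≤ e (ℕ.<⇒≤ (n<2^lg n))))) ⟩
  suc ⌊log₂ (2 ^ lg c * (2 ^ lg n) ^ e) ⌋ ≡⟨ cong (λ m → suc ⌊log₂ (2 ^ lg c * m) ⌋) (ℕ.^-*-assoc 2 (lg n) e) ⟩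
  suc ⌊log₂ (2 ^ lg c * 2 ^ (lg n * e)) ⌋ ≡⟨ cong (λ m → suc ⌊log₂ m ⌋) (ℕ.^-distribˡ-+-* 2 (lg c) (lg n * e)) ⟨
  suc ⌊log₂ (2 ^ (lg c + lg n * e)) ⌋   ≡⟨ cong suc (⌊log₂[2^n]⌋≡n (lg c + lg n * e)) ⟩
  suc (lg c) + lg n * e                 ≤⟨ ℕ.+-mono-≤ (ℕ.m≤m*n (suc (lg c)) (lg n)) (ℕ.≤-reflexive (ℕ.*-comm (lg n) e)) ⟩
  suc (lg c) * lg n + e * lg n          ≡⟨ ℕ.*-distribʳ-+ (lg n) (suc (lg c)) e ⟨
  suc (lg c + e) * lg n                 ∎
  where open ℕ.≤-Reasoning

-- What the operation bound uses of the cost function, so that one proof serves both `lg` and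
-- `lglg`. `positive` absorbs the constant overhead of an operation, `polynomial` the crude estimate
-- of a bin's size.
record Logarithmic (f : ℕ → ℕ) : Set where
  field
    mono       : ∀ {m n} → m ≤ n → f m ≤ f n
    positive   : ∀ n → 1 ≤ f n
    polynomial : ∀ c e → ∃[ C ] (∀ n → f (c * n ^ e) ≤ C * f n)

lg-logarithmic : Logarithmic lg
lg-logarithmic = record
  { mono       = lg-mono
  ; positive   = λ _ → s≤s z≤n
  ; polynomial = λ c e → suc (lg c + e) , lg-polynomial c e
  }

lglg-logarithmic : Logarithmic lglg
lglg-logarithmic = record
  { mono       = λ m≤n → lg-mono (lg-mono m≤n)
  ; positive   = λ _ → s≤s z≤n
  -- The inner logarithm of a polynomial in `n` is at most a polynomial of degree 1 in `lg n`, to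
  -- which the same lemma applies again.
  ; polynomial = λ c e → let C = suc (lg c + e) in suc (lg C + 1) , λ n → begin
      lg (lg (c * n ^ e))           ≤⟨ lg-mono (lg-polynomial c e n) ⟩
      lg (C * lg n)                 ≡⟨ cong (λ m → lg (C * m)) (ℕ.^-identityʳ (lg n)) ⟨
      lg (C * lg n ^ 1)             ≤⟨ lg-polynomial C 1 (lg n) ⟩
      suc (lg C + 1) * lg (lg n)    ∎
  }
  where open ℕ.≤-Reasoning

-- Increasing lists and their gaps

add-↭ : ∀ x A → add x A ↭ x ∷ A
add-↭ = InsertionSort.insert-↭ ℤ.≤-decTotalOrder

length-add : ∀ x A → length (add x A) ≡ suc (length A)
length-add x A = ↭-length (add-↭ x A)

∈-add⁻ : ∀ {x y} A → y ∈ add x A → y ∈ x ∷ A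
∈-add⁻ {x} A = ∈-resp-↭ (add-↭ x A)

∈-add⁺ : ∀ {x y} A → y ∈ x ∷ A → y ∈ add x A
∈-add⁺ {x} A = ∈-resp-↭ (↭-sym (add-↭ x A))

∷-increasing : ∀ {x A} → All (x ℤ.<_) A → Increasing A → Increasing (x ∷ A)
∷-increasing []      []  = [-]
∷-increasing (p ∷ _) inc = p ∷ inc

head< : ∀ {x A} → Increasing (x ∷ A) → All (x ℤ.<_) A
head< [-]       = []
head< (p ∷ inc) = Linked.Linked⇒All ℤ.<-trans p inc

add-increasing : ∀ {x} A → x ∉ A → Increasing A → Increasing (add x A)
add-increasing []      _   _   = [-]
add-increasing {x} (y ∷ A) x∉A inc with x ℤ.≤? y
... | yes x≤y = ℤ.≤∧≢⇒< x≤y (x∉A ∘ here) ∷ inc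
... | no  x≰y = ∷-increasing
  (All.tabulate (y< ∘ ∈-add⁻ A))
  (add-increasing A (x∉A ∘ there) (Linked.tail inc))
  where
  y< : ∀ {z} → z ∈ x ∷ A → y ℤ.< z
  y< (here refl) = ℤ.≰⇒> x≰y
  y< (there z∈A) = All.lookup (head< inc) z∈A

remove-increasing : ∀ {x A} → Increasing A → Increasing (remove x A)
remove-increasing {x} = Linked.filter⁺ (λ y → ¬? (y ℤ.≟ x)) ℤ.<-trans

∈-remove⁺ : ∀ {x y A} → y ∈ A → y ≢ x → y ∈ remove x A
∈-remove⁺ {x} = ∈-filter⁺ (λ y → ¬? (y ℤ.≟ x))

∈-remove⁻ : ∀ {x y A} → y ∈ remove x A → y ∈ A × y ≢ x
∈-remove⁻ {x} = ∈-filter⁻ (λ y → ¬? (y ℤ.≟ x))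

length-remove-∈ : ∀ {x A} → x ∈ A → length (remove x A) < length A
length-remove-∈ {x} {A} x∈A = List.filter-notAll (λ y → ¬? (y ℤ.≟ x)) A
  (Any.map (λ x≡y y≢x → y≢x (sym x≡y)) x∈A)

-- In a strictly increasing list `x` occurs at most once. This limits the survivors lost by one
-- deletion.
length-remove-≥ : ∀ x {A} → Increasing A → length A ≤ suc (length (remove x A))
length-remove-≥ x {[]}    _   = z≤n
length-remove-≥ x {y ∷ A} inc with y ℤ.≟ x
... | yes refl = s≤s (ℕ.≤-reflexive (cong length (sym
      (List.filter-all (λ z → ¬? (z ℤ.≟ y)) (All.map (λ y<z z≡y → ℤ.<⇒≢ y<z (sym z≡y)) (head< inc))))))
... | no  _    = s≤s (length-remove-≥ x (Linked.tail inc))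

∈-tail : ∀ {a z A} → a ℤ.< z → z ∈ a ∷ A → z ∈ A
∈-tail a<z (here refl) = contradiction a<z (ℤ.<-irrefl refl)
∈-tail a<z (there z∈A) = z∈A

increasing-⊆-length : ∀ {T A} → Increasing T → Increasing A → T ⊆ A → length T ≤ length A
increasing-⊆-length {[]}    {A}     _    _    _   = z≤n
increasing-⊆-length {t ∷ T} {[]}    _    _    T⊆A = contradiction (T⊆A (here refl)) λ ()
increasing-⊆-length {t ∷ T} {a ∷ A} incT incA T⊆A with T⊆A (here refl)
... | here refl = s≤s (increasing-⊆-length (Linked.tail incT) (Linked.tail incA) λ z∈T →
        ∈-tail (All.lookup (head< incT) z∈T) (T⊆A (there z∈T)))
... | there t∈A = ℕ.m≤n⇒m≤1+n (increasing-⊆-length incT (Linked.tail incA) λ z∈T →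
        ∈-tail (a<z z∈T) (T⊆A z∈T))
  where
  a<z : ∀ {z} → z ∈ t ∷ T → a ℤ.< z
  a<z (here refl) = All.lookup (head< incA) t∈A
  a<z (there z∈T) = ℤ.<-trans (All.lookup (head< incA) t∈A) (All.lookup (head< incT) z∈T)

final-∈ : ∀ x A → final (x ∷ A) ∈ x ∷ A
final-∈ x []      = here refl
final-∈ x (y ∷ A) = there (final-∈ y A)

first≤ : ∀ {x A} → Increasing A → x ∈ A → first A ℤ.≤ x
first≤ {A = a ∷ A} inc (here refl) = ℤ.≤-refl
first≤ {A = a ∷ A} inc (there x∈A) = ℤ.<⇒≤ (All.lookup (head< inc) x∈A)

≤final : ∀ {x A} → Increasing A → x ∈ A → x ℤ.≤ final A
≤final {A = a ∷ []}    inc       (here refl) = ℤ.≤-refl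
≤final {A = a ∷ b ∷ A} (p ∷ inc) (here refl) = ℤ.≤-trans (ℤ.<⇒≤ p) (≤final inc (here refl))
≤final {A = a ∷ b ∷ A} (p ∷ inc) (there x∈A) = ≤final inc x∈A

first≤final : ∀ {A} → Increasing A → first A ℤ.≤ final A
first≤final {[]}    _   = ℤ.≤-refl
first≤final {a ∷ A} inc = ≤final inc (here refl)

first<final : ∀ {A} → Increasing A → 2 ≤ length A → first A ℤ.< final A
first<final {_ ∷ []}    _           (s≤s ())
first<final {_ ∷ _ ∷ _} (a<b ∷ inc) _ = ℤ.<-≤-trans a<b (≤final inc (here refl))

-- The span of a set and its gaps

span : List ℤ → ℕ
span A = ℤ.∣ final A ℤ.- first A ∣

+∣-∣ : ∀ {x y} → x ℤ.≤ y → + ℤ.∣ y ℤ.- x ∣ ≡ y ℤ.- x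
+∣-∣ x≤y = ℤ.0≤i⇒+∣i∣≡i (ℤ.i≤j⇒0≤j-i x≤y)

+span : ∀ {A} → Increasing A → + span A ≡ final A ℤ.- first A
+span inc = +∣-∣ (first≤final inc)

span-mono : ∀ {T A} → Increasing T → Increasing A → T ⊆ A → span T ≤ span A
span-mono {[]}    _    _    _   = z≤n
span-mono {t ∷ T} incT incA T⊆A = ℤ.drop‿+≤+ (subst₂ ℤ._≤_ (sym (+span incT)) (sym (+span incA))
  (ℤ.+-mono-≤ (≤final incA (T⊆A (final-∈ t T))) (ℤ.neg-mono-≤ (first≤ incA (T⊆A (here refl))))))

-- Telescoping: the span is the sum of the gaps, and a uniform bound on the gaps bounds it by that
-- value times their number.
span-∷ : ∀ {x y A} → Increasing (x ∷ y ∷ A) → span (x ∷ y ∷ A) ≡ ℤ.∣ y ℤ.- x ∣ + span (y ∷ A)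
span-∷ {x} {y} {A} inc@(x<y ∷ inc′) = ℤ.+-injective (begin
  + span (x ∷ y ∷ A)                           ≡⟨ +span inc ⟩
  z ℤ.- x                                      ≡⟨ solve 3 (λ x y z → z :- x := (y :- x) :+ (z :- y)) refl x y z ⟩
  (y ℤ.- x) ℤ.+ (z ℤ.- y)                      ≡⟨ cong₂ ℤ._+_ (+∣-∣ (ℤ.<⇒≤ x<y)) (+span inc′) ⟨
  + ℤ.∣ y ℤ.- x ∣ ℤ.+ + span (y ∷ A)           ≡⟨ ℤ.pos-+ _ (span (y ∷ A)) ⟨
  + (ℤ.∣ y ℤ.- x ∣ + span (y ∷ A))             ∎)
  where
  open ≡-Reasoning
  open ℤSolver.+-*-Solver
  z = final (y ∷ A)

span-≤ : ∀ {G A} → Increasing A → All (_≤ G) (gaps A) → span A ≤ G * ℕ.pred (length A)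
span-≤ {G} {[]}        _   _ = z≤n
span-≤ {G} {x ∷ []}    _   _ = ℕ.≤-trans (ℕ.≤-reflexive (cong ℤ.∣_∣ (ℤ.+-inverseʳ x))) z≤n
span-≤ {G} {x ∷ y ∷ A} inc@(_ ∷ inc′) (g≤G ∷ gs≤G) = begin
  span (x ∷ y ∷ A)                  ≡⟨ span-∷ inc ⟩
  ℤ.∣ y ℤ.- x ∣ + span (y ∷ A)      ≤⟨ ℕ.+-mono-≤ g≤G (span-≤ inc′ gs≤G) ⟩
  G + G * length A                  ≡⟨ ℕ.*-suc G (length A) ⟨
  G * suc (length A)                ∎
  where open ℕ.≤-Reasoning

span-≥ : ∀ {g A} → Increasing A → All (g ≤_) (gaps A) → g * ℕ.pred (length A) ≤ span A
span-≥ {g} {[]}        _   _ = ℕ.≤-reflexive (ℕ.*-zeroʳ g)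
span-≥ {g} {x ∷ []}    _   _ = ℕ.≤-trans (ℕ.≤-reflexive (ℕ.*-zeroʳ g)) z≤n
span-≥ {g} {x ∷ y ∷ A} inc@(_ ∷ inc′) (g≤ ∷ g≤s) = begin
  g * suc (length A)                ≡⟨ ℕ.*-suc g (length A) ⟩
  g + g * length A                  ≤⟨ ℕ.+-mono-≤ g≤ (span-≥ inc′ g≤s) ⟩
  ℤ.∣ y ℤ.- x ∣ + span (y ∷ A)      ≡⟨ span-∷ inc ⟨
  span (x ∷ y ∷ A)                  ∎
  where open ℕ.≤-Reasoning

gap-∈ : ∀ {g A x y} → Increasing A → All (g ≤_) (gaps A) → x ∈ A → y ∈ A → x ℤ.< y → g ≤ ℤ.∣ y ℤ.- x ∣
gap-∈ {A = a ∷ A} inc _ (here refl) (here refl) x<y = contradiction x<y (ℤ.<-irrefl refl)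
gap-∈ {A = a ∷ b ∷ A} inc@(_ ∷ inc′) (g≤ ∷ _) (here refl) (there y∈A) x<y =
  ℕ.≤-trans g≤ (ℤ.drop‿+≤+ (subst₂ ℤ._≤_ (sym (+∣-∣ (ℤ.<⇒≤ (Linked.head inc)))) (sym (+∣-∣ (ℤ.<⇒≤ x<y)))
    (ℤ.+-monoˡ-≤ (ℤ.- a) (first≤ inc′ y∈A))))
gap-∈ {A = a ∷ b ∷ A} inc _ (there x∈A) (here refl) x<y =
  contradiction x<y (ℤ.<-asym (All.lookup (head< inc) x∈A))
gap-∈ {A = a ∷ b ∷ A} (_ ∷ inc) (_ ∷ g≤) (there x∈A) (there y∈A) x<y = gap-∈ inc g≤ x∈A y∈A x<y

-- A gap of a subset is a sum of gaps of `A`, so lower bounds are inherited. Upper bounds are not,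
-- which is why bins and survivors are only ever estimated from below by gaps.
gaps-⊆ : ∀ {g T A} → Increasing T → Increasing A → T ⊆ A → All (g ≤_) (gaps A) → All (g ≤_) (gaps T)
gaps-⊆ []           _    _   _  = []
gaps-⊆ [-]          _    _   _  = []
gaps-⊆ (x<y ∷ incT) incA T⊆A g≤ =
  gap-∈ incA g≤ (T⊆A (here refl)) (T⊆A (there (here refl))) x<y ∷ gaps-⊆ incT incA (T⊆A ∘ there) g≤

gaps-pos : ∀ {A} → Increasing A → All (1 ≤_) (gaps A)
gaps-pos []  = []
gaps-pos [-] = []
gaps-pos (x<y ∷ inc) = ℤ.drop‿+≤+ (subst (1ℤ ℤ.≤_) (sym (+∣-∣ (ℤ.<⇒≤ x<y)))
  (ℤ.i<j⇒suc[i]≤j (i<j⇒0<j-i x<y))) ∷ gaps-pos inc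

module _ {A : List ℤ} (inc : Increasing A) (2≤∣A∣ : 2 ≤ length A) where

  -- Strict increase makes all gaps positive and two elements give at least one gap, so neither junk
  -- value of the ratio occurs.
  gapRatio-extrema : ∃[ g ] ∃[ G ] (1 ≤ g) × (g ≤ G) × All (g ≤_) (gaps A) × All (_≤ G) (gaps A)
                   × (gapRatio A ≡ fromℕ G ÷₀ fromℕ g)
  gapRatio-extrema with gaps A in eq | gaps-pos inc
  ... | g ∷ gs | 1≤g ∷ 1≤gs =
      min g gs , max g gs , v≤min⁺ 1≤g 1≤gs , ℕ.≤-trans (min≤⊤ g gs) (⊥≤max g gs)
    , min≤⊤ g gs ∷ min≤xs g gs , ⊥≤max g gs ∷ xs≤max g gs , refl
  ... | [] | [] = contradiction eq (nonEmpty 2≤∣A∣)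
    where
    nonEmpty : ∀ {A} → 2 ≤ length A → gaps A ≢ []
    nonEmpty {_ ∷ []}    (s≤s ())
    nonEmpty {_ ∷ _ ∷ _} _ ()

  1≤gapRatio : 1ℚ ℚ.≤ gapRatio A
  1≤gapRatio with gapRatio-extrema
  ... | g , G , 1≤g , g≤G , _ , _ , eq = subst (1ℚ ℚ.≤_) (sym eq) (*≤⇒≤÷₀ (fromℕ-pos 1≤g)
    (subst (ℚ._≤ fromℕ G) (sym (ℚ.*-identityˡ (fromℕ g))) (fromℕ-mono-≤ g≤G)))

  -- g is the smallest gap of A.
  gap-bounds : ∀ D → gapRatio A ℚ.≤ fromℕ D → ∃[ g ]
      (1 ≤ g)
    × (∀ {T} → Increasing T → T ⊆ A → g * ℕ.pred (length T) ≤ span T)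
    × (span A ≤ D * g * ℕ.pred (length A))
  gap-bounds D ratio≤D with gapRatio-extrema
  ... | g , G , 1≤g , g≤G , g≤gaps , gaps≤G , eq =
      g , 1≤g
    , (λ incT T⊆A → span-≥ incT (gaps-⊆ incT inc T⊆A g≤gaps))
    , ℕ.≤-trans (span-≤ inc gaps≤G) (ℕ.*-monoˡ-≤ (ℕ.pred (length A)) G≤Dg)
    where
    G≤Dg : G ≤ D * g
    G≤Dg = fromℕ-cancel-≤ (subst (fromℕ G ℚ.≤_) (sym (fromℕ-* D g))
      (÷₀≤⇒≤* (fromℕ-pos 1≤g) (subst (ℚ._≤ fromℕ D) eq ratio≤D)))

-- Occupancy of a bin

-- Here `S` is the snapshot, `A` the current set, `T` the survivors and `X` a bin; `D` stands for Δ
-- and `R` for n / k. The three factors `D` come from the estimate in the bin size, from comparing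
-- the largest with the smallest gap in `S`, and from the same in `A`. The constant is 5 for the bin
-- size times 4 for the survivors.
occupancy : ∀ D R {S A T X k} .{{_ : NonZero k}} →
  Increasing S → 2 ≤ length S → gapRatio S ℚ.≤ fromℕ D →
  Increasing A → 2 ≤ length A → gapRatio A ℚ.≤ fromℕ D →
  Increasing T → T ⊆ S → T ⊆ A → length S ≤ 4 * ℕ.pred (length T) →
  Increasing X → X ⊆ A → span X * k ≤ 5 * D * span S →
  length A ≤ R * k → ℕ.pred (length X) ≤ 20 * D ^ 3 * R
occupancy D R {S} {A} {T} {X} {k}
  incS 2≤S ratioS incA 2≤A ratioA incT T⊆S T⊆A S≤4T incX X⊆A diameter A≤Rk
  with gap-bounds incS 2≤S D ratioS | gap-bounds incA 2≤A D ratioA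
... | gS , _ , lowerS , upperS | g , 1≤g , lowerA , upperA =
  ℕ.*-cancelʳ-≤ (ℕ.pred (length X)) (20 * D ^ 3 * R) (g * k) {{g*k≢0}} (begin
    ℕ.pred (length X) * (g * k)       ≡⟨ left-shape (ℕ.pred (length X)) g k ⟩
    g * ℕ.pred (length X) * k         ≤⟨ ℕ.*-monoˡ-≤ k (lowerA incX X⊆A) ⟩
    span X * k                        ≤⟨ diameter ⟩
    5 * D * span S                    ≤⟨ ℕ.*-monoʳ-≤ (5 * D) spanS ⟩
    5 * D * (4 * D * (D * g * (R * k))) ≡⟨ right-shape D g R k ⟩
    20 * D ^ 3 * R * (g * k)          ∎)
  where
  open ℕ.≤-Reasoning
  g*k≢0 : NonZero (g * k)
  g*k≢0 = ℕ.m*n≢0 g k {{ℕ.>-nonZero 1≤g}}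
  left-shape : ∀ x g k → x * (g * k) ≡ g * x * k
  left-shape = solve-∀
  middle-shape : ∀ d g t → d * g * (4 * t) ≡ 4 * d * (g * t)
  middle-shape = solve-∀
  right-shape : ∀ d g r k → 5 * d * (4 * d * (d * g * (r * k))) ≡ 20 * (d * (d * (d * 1))) * r * (g * k)
  right-shape = solve-∀
  -- The snapshot's own smallest gap `gS` drops out: it enters from above with |S| and is consumed
  -- by the span of `T`, whose gaps are at least `gS`.
  spanS : span S ≤ 4 * D * (D * g * (R * k))
  spanS = begin
    span S                              ≤⟨ upperS ⟩
    D * gS * ℕ.pred (length S)          ≤⟨ ℕ.*-monoʳ-≤ (D * gS) (ℕ.≤-trans (ℕ.pred[n]≤n) S≤4T) ⟩
    D * gS * (4 * ℕ.pred (length T))    ≡⟨ middle-shape D gS (ℕ.pred (length T)) ⟩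
    4 * D * (gS * ℕ.pred (length T))    ≤⟨ ℕ.*-monoʳ-≤ (4 * D) (lowerS incT T⊆S) ⟩
    4 * D * span T                      ≤⟨ ℕ.*-monoʳ-≤ (4 * D) (span-mono incT incA T⊆A) ⟩
    4 * D * span A                      ≤⟨ ℕ.*-monoʳ-≤ (4 * D) upperA ⟩
    4 * D * (D * g * ℕ.pred (length A)) ≤⟨ ℕ.*-monoʳ-≤ (4 * D) (ℕ.*-monoʳ-≤ (D * g) (ℕ.≤-trans ℕ.pred[n]≤n A≤Rk)) ⟩
    4 * D * (D * g * (R * k))           ∎

-- One factor 2 is for the half that may have been deleted, the other for passing from elements to
-- gaps: from 2 ≤ m < 2 s follows s ≥ 2, hence s ≤ 2 (s - 1).
survivors-bound : ∀ {m s u} → 2 ≤ m → 2 * u < m → m ≤ s + u → m ≤ 4 * ℕ.pred s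
survivors-bound {m} {s} {u} 2≤m 2u<m m≤s+u = begin
  m                ≤⟨ ℕ.<⇒≤ m<2s ⟩
  2 * s            ≤⟨ double-pred s 2≤s ⟩
  4 * ℕ.pred s     ∎
  where
  open ℕ.≤-Reasoning
  m<2s : m < 2 * s
  m<2s = ℕ.+-cancelʳ-< m m (2 * s) (begin-strict
    m + m          ≡⟨ cong (m ℕ.+_) (ℕ.+-identityʳ m) ⟨
    2 * m          ≤⟨ ℕ.*-monoʳ-≤ 2 m≤s+u ⟩
    2 * (s + u)    ≡⟨ ℕ.*-distribˡ-+ 2 s u ⟩
    2 * s + 2 * u  <⟨ ℕ.+-monoʳ-< (2 * s) 2u<m ⟩
    2 * s + m      ∎)
  2≤s : 2 ≤ s
  2≤s = ℕ.*-cancelˡ-< 2 1 s (ℕ.≤-<-trans 2≤m m<2s)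
  double-pred : ∀ s → 2 ≤ s → 2 * s ≤ 4 * ℕ.pred s
  double-pred (suc zero)    (s≤s ())
  double-pred (suc (suc s)) _ = ℕ.≤-trans (ℕ.m≤m+n (2 * suc (suc s)) (2 * s)) (ℕ.≤-reflexive (shape s))
    where
    shape : ∀ s → 2 * (2 + s) + 2 * s ≡ 4 * (1 + s)
    shape = solve-∀

-- The estimate may overshoot Δ by a factor 2 when it is doubled, so the factor 2 Δ̂ + 1 of the
-- range is at most 4 D + 1, and 1 ≤ D makes this at most 5 D.
bin-span : ∀ D {k Δ̂ S X i} .{{_ : NonZero k}} →
  let open Subdivision k Δ̂ S using (locate) in
  Increasing S → 2 ≤ length S → 0ℚ ℚ.≤ Δ̂ → Δ̂ ℚ.≤ fromℕ (2 * D) → 1 ≤ D →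
  Increasing X → (∀ {x} → x ∈ X → locate x ≡ just i) →
  span X * k ≤ 5 * D * span S
bin-span _ {X = []} _ _ _ _ _ _ _ = z≤n
bin-span D {k} {Δ̂} {S} {X@(x ∷ Y)} incS 2≤S 0≤Δ̂ Δ̂≤2D 1≤D incX X⊆bin = fromℕ-cancel-≤ (begin
  fromℕ (span X * k)                      ≡⟨ fromℕ-* (span X) k ⟩
  fromℕ (span X) ℚ.* fromℕ k              ≡⟨ cong (λ z → fromℤ z ℚ.* fromℕ k) (+span incX) ⟩
  fromℤ (final X ℤ.- first X) ℚ.* fromℕ k ≤⟨ locate-diameter {first X} {final X} (X⊆bin (here refl)) (X⊆bin (final-∈ x Y)) ⟩
  (2ℚ ℚ.* Δ̂ ℚ.+ 1ℚ) ℚ.* fromℤ (final S ℤ.- first S)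
    ≡⟨ cong (λ z → (2ℚ ℚ.* Δ̂ ℚ.+ 1ℚ) ℚ.* fromℤ z) (+span incS) ⟨
  (2ℚ ℚ.* Δ̂ ℚ.+ 1ℚ) ℚ.* fromℕ (span S)
    ≤⟨ ℚ.*-monoʳ-≤-nonNeg (fromℕ (span S)) {{fromℕ-nonNeg (span S)}} factor≤ ⟩
  fromℕ (5 * D) ℚ.* fromℕ (span S)        ≡⟨ fromℕ-* (5 * D) (span S) ⟨
  fromℕ (5 * D * span S)                  ∎)
  where
  open ℚ.≤-Reasoning
  open BinDiameter k Δ̂ S 0≤Δ̂ (first<final incS 2≤S) using (locate-diameter)
  4D+1≤5D : 2 * (2 * D) + 1 ≤ 5 * D
  4D+1≤5D = ℕ.≤-trans (ℕ.+-monoʳ-≤ (2 * (2 * D)) 1≤D) (ℕ.≤-reflexive (shape D))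
    where
    shape : ∀ d → 2 * (2 * d) + d ≡ 5 * d
    shape = solve-∀
  factor≤ : 2ℚ ℚ.* Δ̂ ℚ.+ 1ℚ ℚ.≤ fromℕ (5 * D)
  factor≤ = begin
    2ℚ ℚ.* Δ̂ ℚ.+ 1ℚ                ≤⟨ ℚ.+-monoˡ-≤ 1ℚ (ℚ.*-monoˡ-≤-nonNeg 2ℚ Δ̂≤2D) ⟩
    2ℚ ℚ.* fromℕ (2 * D) ℚ.+ 1ℚ    ≡⟨ cong (ℚ._+ 1ℚ) (fromℕ-* 2 (2 * D)) ⟨
    fromℕ (2 * (2 * D)) ℚ.+ 1ℚ     ≡⟨ fromℤ-+ (+ (2 * (2 * D))) 1ℤ ⟨
    fromℕ (2 * (2 * D) + 1)        ≤⟨ fromℕ-mono-≤ 4D+1≤5D ⟩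
    fromℕ (5 * D)                  ∎

-- Since n / k ≥ 1 / κ and P ≥ 1, each factor of (n / k) P is bounded by a multiple of
-- the product.
factor-bounds : ∀ κ N {k n P} .{{_ : NonZero k}} → k ≤ κ * n → 1ℚ ℚ.≤ P →
  fromℕ n ÷₀ fromℕ k ℚ.* P ℚ.≤ fromℕ N → (n ≤ N * k) × (P ℚ.≤ fromℕ (κ * N))
factor-bounds κ N {k} {n} {P} k≤κn 1≤P qP≤N = n≤Nk , P≤κN
  where
  open ℚ.≤-Reasoning
  q = fromℕ n ÷₀ fromℕ k
  0<k : 0ℚ ℚ.< fromℕ k
  0<k = fromℕ-pos (ℕ.>-nonZero⁻¹ k)
  0≤q : 0ℚ ℚ.≤ q
  0≤q = *≤⇒≤÷₀ 0<k (subst (ℚ._≤ fromℕ n) (sym (ℚ.*-zeroˡ (fromℕ k))) (fromℕ-mono-≤ {0} {n} z≤n))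
  n≤Nk : n ≤ N * k
  n≤Nk = fromℕ-cancel-≤ (subst (fromℕ n ℚ.≤_) (sym (fromℕ-* N k)) (÷₀≤⇒≤* 0<k (begin
    q           ≡⟨ ℚ.*-identityʳ q ⟨
    q ℚ.* 1ℚ    ≤⟨ ℚ.*-monoˡ-≤-nonNeg q {{ℚ.nonNegative 0≤q}} 1≤P ⟩
    q ℚ.* P     ≤⟨ qP≤N ⟩
    fromℕ N     ∎)))
  1≤κq : 1ℚ ℚ.≤ fromℕ κ ℚ.* q
  1≤κq = ℚ.*-cancelʳ-≤-pos (fromℕ k) {{ℚ.positive 0<k}} (begin
    1ℚ ℚ.* fromℕ k               ≡⟨ ℚ.*-identityˡ (fromℕ k) ⟩
    fromℕ k                      ≤⟨ fromℕ-mono-≤ k≤κn ⟩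
    fromℕ (κ * n)                ≡⟨ fromℕ-* κ n ⟩
    fromℕ κ ℚ.* fromℕ n          ≡⟨ cong (fromℕ κ ℚ.*_) (÷₀-* (fromℕ n) 0<k) ⟨
    fromℕ κ ℚ.* (q ℚ.* fromℕ k)  ≡⟨ ℚ.*-assoc (fromℕ κ) q (fromℕ k) ⟨
    fromℕ κ ℚ.* q ℚ.* fromℕ k    ∎)
  P≤κN : P ℚ.≤ fromℕ (κ * N)
  P≤κN = begin
    P                       ≡⟨ ℚ.*-identityˡ P ⟨
    1ℚ ℚ.* P                ≤⟨ ℚ.*-monoʳ-≤-nonNeg P {{ℚ.nonNegative (ℚ.≤-trans (ℚ.nonNegative⁻¹ 1ℚ) 1≤P)}} 1≤κq ⟩
    fromℕ κ ℚ.* q ℚ.* P     ≡⟨ ℚ.*-assoc (fromℕ κ) q P ⟩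
    fromℕ κ ℚ.* (q ℚ.* P)   ≤⟨ ℚ.*-monoˡ-≤-nonNeg (fromℕ κ) {{fromℕ-nonNeg κ}} qP≤N ⟩
    fromℕ κ ℚ.* fromℕ N     ≡⟨ fromℕ-* κ N ⟨
    fromℕ (κ * N)           ∎

Δmax-upper : ∀ ops A → All (λ B → gapRatio B ℚ.≤ Δmax ops A) (history ops A)
Δmax-upper ops A = go (history ops A)
  where
  go : ∀ Bs → All (λ B → gapRatio B ℚ.≤ foldr ℚ._⊔_ 0ℚ (map gapRatio Bs)) Bs
  go []       = []
  go (B ∷ Bs) = ℚ.p≤p⊔q (gapRatio B) r ∷ All.map (λ p → ℚ.≤-trans p (ℚ.p≤q⊔p (gapRatio B) r)) (go Bs)
    where r = foldr ℚ._⊔_ 0ℚ (map gapRatio Bs)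

-- Invariants of the structure

history-head : ∀ {Q : List ℤ → Set} ops {A} → All Q (history ops A) → Q A
history-head []      (p ∷ _) = p
history-head (_ ∷ _) (p ∷ _) = p

history-++-head : ∀ {Q : List ℤ → Set} before {after A} →
  All Q (history (before ++ after) A) → Q (applyAll before A)
history-++-head []           {after} ps = history-head after ps
history-++-head (_ ∷ before) (_ ∷ ps)   = history-++-head before ps

p≤2p : ∀ {p} → 0ℚ ℚ.≤ p → p ℚ.≤ 2ℚ ℚ.* p
p≤2p {p} 0≤p = subst (ℚ._≤ 2ℚ ℚ.* p) (ℚ.*-identityˡ p)
  (ℚ.*-monoʳ-≤-nonNeg p {{ℚ.nonNegative 0≤p}} (fromℕ-mono-≤ {1} {2} (s≤s z≤n)))

module Correctness (SD : Dictionary) (t : Overhead) (k : ℕ) .{{_ : NonZero k}} where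

  private module SD = Dictionary SD
  open Binning SD t k
  open Structure

  -- A view of `rebuildDue`: matching on it yields the inequality behind the decision in place of a
  -- Boolean.
  data Due (D : Structure) : Maybe ℚ → Set where
    ratio-exceeded : Δ̂ D ℚ.< gapRatio (current D) → Due D (just (gapRatio (current D) ℚ.⊔ 2ℚ ℚ.* Δ̂ D))
    many-updates   : length (snapshot D) ≤ 2 * updates D → Due D (just (Δ̂ D))
    not-due        : 2 * updates D < length (snapshot D) → Due D nothing

  due : ∀ D → Due D (rebuildDue D)
  due D = decide (Δ̂ D ℚ.<? gapRatio (current D)) (length (snapshot D) ℕ.≤? 2 * updates D)
    where
    decide : (p? : Dec (Δ̂ D ℚ.< gapRatio (current D))) (q? : Dec (length (snapshot D) ≤ 2 * updates D)) →
      Due D (if does p? then just (gapRatio (current D) ℚ.⊔ 2ℚ ℚ.* Δ̂ D)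
             else if does q? then just (Δ̂ D) else nothing)
    decide (yes p) _       = ratio-exceeded p
    decide (no _)  (yes q) = many-updates q
    decide (no _)  (no ¬q) = not-due (ℕ.≰⇒> ¬q)

  current-maintain : ∀ D → current (maintain D) ≡ current D
  current-maintain D with rebuildDue D
  ... | just _  = refl
  ... | nothing = refl

  current-step : ∀ op D → current (step op D) ≡ apply op (current D)
  current-step (search x) D = refl
  current-step (insert x) D = current-maintain (perform (insert x) D)
  current-step (delete x) D = current-maintain (perform (delete x) D)

  current-run : ∀ ops D → current (run ops D) ≡ applyAll ops (current D)
  current-run []         D = refl
  current-run (op ∷ ops) D = trans (current-run ops (step op D)) (cong (applyAll ops) (current-step op D))

  bin : Structure → Fin k → List ℤ
  bin D i = SD.contents (lookup (bins D) i)

  -- What holds even between `perform` and `maintain`, when a rebuild may be overdue; `Invariant`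
  -- adds the bound on updates that `maintain` restores. The survivors are carried as an explicit
  -- list with a lower bound on their number, which each update adjusts locally. Both directions for
  -- bins are kept, since insertion into a bin needs absence there and deletion needs presence.
  record Consistent (P : ℚ) (D : Structure) : Set where
    field
      current-increasing  : Increasing (current D)
      snapshot-increasing : Increasing (snapshot D)
      snapshot-gapped     : 2 ≤ length (snapshot D)
      snapshot-ratio      : gapRatio (snapshot D) ℚ.≤ P
      0≤Δ̂                 : 0ℚ ℚ.≤ Δ̂ D
      Δ̂≤2P                : Δ̂ D ℚ.≤ 2ℚ ℚ.* P
      survivors            : List ℤ
      survivors-increasing : Increasing survivors
      survivors⊆snapshot   : survivors ⊆ snapshot D
      survivors⊆current    : survivors ⊆ current D
      survivors-many       : length (snapshot D) ≤ length survivors + updates D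
      bin⁻ : ∀ {i x} → x ∈ bin D i → x ∈ current D × locate D x ≡ just i
      bin⁺ : ∀ {i x} → x ∈ current D → locate D x ≡ just i → x ∈ bin D i

  record Invariant (P : ℚ) (D : Structure) : Set where
    field
      consistent  : Consistent P D
      few-updates : 2 * updates D < length (snapshot D)
    open Consistent consistent public

  Admissible : ℚ → List ℤ → Set
  Admissible P B = (2 ≤ length B) × (gapRatio B ℚ.≤ P)

  lookup-inBin : ∀ {x i f} D → locate D x ≡ just i → lookup (inBin x f D) i ≡ f (lookup (bins D) i)
  lookup-inBin {x} D eq with locate D x
  lookup-inBin D refl | just i = Vec.lookup∘updateAt i (bins D)

  lookup-inBin′ : ∀ {x i f} D → locate D x ≢ just i → lookup (inBin x f D) i ≡ lookup (bins D) i
  lookup-inBin′ {x} {i} D neq with locate D x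
  ... | just j  = Vec.lookup∘updateAt′ i j (λ i≡j → neq (cong just (sym i≡j))) (bins D)
  ... | nothing = refl

  buildWith-invariant : ∀ {P Δ̂ A} → Increasing A → Admissible P A →
    0ℚ ℚ.≤ Δ̂ → Δ̂ ℚ.≤ 2ℚ ℚ.* P → Invariant P (buildWith Δ̂ A)
  buildWith-invariant {P} {Δ̂} {A} inc (2≤∣A∣ , ratio≤P) 0≤Δ̂ Δ̂≤2P = record
    { consistent = record
      { current-increasing   = inc
      ; snapshot-increasing  = inc
      ; snapshot-gapped      = 2≤∣A∣
      ; snapshot-ratio       = ratio≤P
      ; 0≤Δ̂                  = 0≤Δ̂
      ; Δ̂≤2P                 = Δ̂≤2P
      ; survivors            = A
      ; survivors-increasing = inc
      ; survivors⊆snapshot   = id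
      ; survivors⊆current    = id
      ; survivors-many       = ℕ.m≤m+n (length A) 0
      ; bin⁻ = λ {i} {x} x∈ → ∈-filter⁻ (inBin? i) (subst (x ∈_) (bin≡ i) x∈)
      ; bin⁺ = λ {i} {x} x∈A eq → subst (x ∈_) (sym (bin≡ i)) (∈-filter⁺ (inBin? i) x∈A eq)
      }
    ; few-updates = ℕ.≤-trans (s≤s z≤n) 2≤∣A∣
    }
    where
    module S = Subdivision k Δ̂ A
    inBin? = λ i x → Maybe.≡-dec Fin._≟_ (S.locate x) (just i)
    bin≡ : ∀ i → bin (buildWith Δ̂ A) i ≡ S.binElements i
    bin≡ i = trans (cong SD.contents (Vec.lookup∘tabulate _ i))
      (SD.build-correct (Linked.filter⁺ (inBin? i) ℤ.<-trans inc))

  insert-consistent : ∀ {P x D} → Consistent P D → x ∉ current D → Consistent P (perform (insert x) D)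
  insert-consistent {P} {x} {D} inv x∉ = record
    { current-increasing   = add-increasing (current D) x∉ current-increasing
    ; snapshot-increasing  = snapshot-increasing
    ; snapshot-gapped      = snapshot-gapped
    ; snapshot-ratio       = snapshot-ratio
    ; 0≤Δ̂                  = 0≤Δ̂
    ; Δ̂≤2P                 = Δ̂≤2P
    -- A snapshot element that was deleted and is now reinserted is not restored; the list stays a
    -- valid underestimate.
    ; survivors            = survivors
    ; survivors-increasing = survivors-increasing
    ; survivors⊆snapshot   = survivors⊆snapshot
    ; survivors⊆current    = ∈-add⁺ (current D) ∘ there ∘ survivors⊆current
    ; survivors-many       = ℕ.≤-trans survivors-many (ℕ.+-monoʳ-≤ (length survivors) (ℕ.n≤1+n (updates D)))
    ; bin⁻                 = bin⁻′
    ; bin⁺                 = bin⁺′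
    }
    where
    open Consistent inv
    D′ = perform (insert x) D

    grown : ∀ {i} → locate D x ≡ just i → bin D′ i ≡ add x (bin D i)
    grown {i} eq = trans (cong SD.contents (lookup-inBin D eq))
      (SD.insert-correct (lookup (bins D) i) (x∉ ∘ proj₁ ∘ bin⁻))

    unchanged : ∀ {i} → locate D x ≢ just i → bin D′ i ≡ bin D i
    unchanged neq = cong SD.contents (lookup-inBin′ D neq)

    bin⁻′ : ∀ {i y} → y ∈ bin D′ i → y ∈ add x (current D) × locate D y ≡ just i
    bin⁻′ {i} {y} y∈ with Maybe.≡-dec Fin._≟_ (locate D x) (just i)
    ... | no  neq = let y∈A , eq = bin⁻ (subst (y ∈_) (unchanged neq) y∈) in
                    ∈-add⁺ (current D) (there y∈A) , eq
    ... | yes eq with ∈-add⁻ (bin D i) (subst (y ∈_) (grown eq) y∈)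
    ...   | here refl = ∈-add⁺ (current D) (here refl) , eq
    ...   | there y∈i = let y∈A , eq = bin⁻ y∈i in ∈-add⁺ (current D) (there y∈A) , eq

    bin⁺′ : ∀ {i y} → y ∈ add x (current D) → locate D y ≡ just i → y ∈ bin D′ i
    bin⁺′ {i} {y} y∈ loc with Maybe.≡-dec Fin._≟_ (locate D x) (just i) | ∈-add⁻ (current D) y∈
    ... | no  neq | here refl = contradiction loc neq
    ... | no  neq | there y∈A = subst (y ∈_) (sym (unchanged neq)) (bin⁺ y∈A loc)
    ... | yes eq  | here refl = subst (y ∈_) (sym (grown eq)) (∈-add⁺ (bin D i) (here refl))
    ... | yes eq  | there y∈A = subst (y ∈_) (sym (grown eq)) (∈-add⁺ (bin D i) (there (bin⁺ y∈A loc)))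

  delete-consistent : ∀ {P x D} → Consistent P D → x ∈ current D → Consistent P (perform (delete x) D)
  delete-consistent {P} {x} {D} inv x∈A = record
    { current-increasing   = remove-increasing current-increasing
    ; snapshot-increasing  = snapshot-increasing
    ; snapshot-gapped      = snapshot-gapped
    ; snapshot-ratio       = snapshot-ratio
    ; 0≤Δ̂                  = 0≤Δ̂
    ; Δ̂≤2P                 = Δ̂≤2P
    -- Whether or not `x` dates from the snapshot, at most one survivor is lost, and the incremented
    -- update count makes up for it in `survivors-many`.
    ; survivors            = remove x survivors
    ; survivors-increasing = remove-increasing survivors-increasing
    ; survivors⊆snapshot   = survivors⊆snapshot ∘ proj₁ ∘ ∈-remove⁻
    ; survivors⊆current    = λ y∈ → let y∈T , y≢x = ∈-remove⁻ y∈ in ∈-remove⁺ (survivors⊆current y∈T) y≢x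
    ; survivors-many       = ℕ.≤-trans survivors-many (ℕ.≤-trans
        (ℕ.+-monoˡ-≤ (updates D) (length-remove-≥ x survivors-increasing))
        (ℕ.≤-reflexive (sym (ℕ.+-suc (length (remove x survivors)) (updates D)))))
    ; bin⁻                 = bin⁻′
    ; bin⁺                 = bin⁺′
    }
    where
    open Consistent inv
    D′ = perform (delete x) D

    shrunk : ∀ {i} → locate D x ≡ just i → bin D′ i ≡ remove x (bin D i)
    shrunk {i} eq = trans (cong SD.contents (lookup-inBin D eq))
      (SD.delete-correct (lookup (bins D) i) (bin⁺ x∈A eq))

    unchanged : ∀ {i} → locate D x ≢ just i → bin D′ i ≡ bin D i
    unchanged neq = cong SD.contents (lookup-inBin′ D neq)

    bin⁻′ : ∀ {i y} → y ∈ bin D′ i → y ∈ remove x (current D) × locate D y ≡ just i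
    bin⁻′ {i} {y} y∈ with Maybe.≡-dec Fin._≟_ (locate D x) (just i)
    ... | no  neq = let y∈A , eq = bin⁻ (subst (y ∈_) (unchanged neq) y∈) in
                    ∈-remove⁺ y∈A (λ { refl → neq eq }) , eq
    ... | yes eq  = let y∈i , y≢x = ∈-remove⁻ {A = bin D i} (subst (y ∈_) (shrunk eq) y∈)
                        y∈A , eq′ = bin⁻ y∈i in
                    ∈-remove⁺ y∈A y≢x , eq′

    bin⁺′ : ∀ {i y} → y ∈ remove x (current D) → locate D y ≡ just i → y ∈ bin D′ i
    bin⁺′ {i} {y} y∈ loc with Maybe.≡-dec Fin._≟_ (locate D x) (just i) | ∈-remove⁻ {A = current D} y∈
    ... | no  neq | y∈A , _   = subst (y ∈_) (sym (unchanged neq)) (bin⁺ y∈A loc)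
    ... | yes eq  | y∈A , y≢x = subst (y ∈_) (sym (shrunk eq)) (∈-remove⁺ (bin⁺ y∈A loc) y≢x)

  -- Doublings do not compound beyond 2 P: the estimate is raised only when it lies below a ratio
  -- that is actually attained, hence below `P`.
  maintain-invariant : ∀ {P D} → Consistent P D → Admissible P (current D) → Invariant P (maintain D)
  maintain-invariant {P} {D} inv adm@(2≤∣A∣ , ratio≤P) with rebuildDue D | due D
  ... | _ | many-updates _ = buildWith-invariant current-increasing adm 0≤Δ̂ Δ̂≤2P
    where open Consistent inv
  ... | _ | not-due few = record { consistent = inv ; few-updates = few }
  ... | _ | ratio-exceeded Δ̂<ratio = buildWith-invariant current-increasing adm
      (ℚ.≤-trans 0≤ratio (ℚ.p≤p⊔q (gapRatio (current D)) (2ℚ ℚ.* Δ̂ D)))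
      (ℚ.⊔-lub
        (ℚ.≤-trans (p≤2p 0≤ratio) (ℚ.*-monoˡ-≤-nonNeg 2ℚ ratio≤P))
        (ℚ.*-monoˡ-≤-nonNeg 2ℚ (ℚ.≤-trans (ℚ.<⇒≤ Δ̂<ratio) ratio≤P)))
    where
    open Consistent inv
    0≤ratio : 0ℚ ℚ.≤ gapRatio (current D)
    0≤ratio = ℚ.≤-trans 0≤Δ̂ (ℚ.<⇒≤ Δ̂<ratio)

  step-invariant : ∀ {P D} op → Invariant P D → Allowed op (current D) →
    Admissible P (apply op (current D)) → Invariant P (step op D)
  step-invariant (search x) inv _  _   = inv
  step-invariant (insert x) inv x∉ adm = maintain-invariant (insert-consistent (Invariant.consistent inv) x∉) adm
  step-invariant (delete x) inv x∈ adm = maintain-invariant (delete-consistent (Invariant.consistent inv) x∈) adm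

  run-invariant : ∀ {P D} before {after} → Invariant P D →
    AllAllowed (before ++ after) (current D) → All (Admissible P) (history (before ++ after) (current D)) →
    let D′ = run before D in
    Invariant P D′ × AllAllowed after (current D′) × All (Admissible P) (history after (current D′))
  run-invariant []           inv allowed         adm       = inv , allowed , adm
  run-invariant {P} {D} (op ∷ ops) {after} inv (ok , allowed) (_ ∷ adm) = run-invariant ops
    (step-invariant op inv ok (history-head (ops ++ after) adm))
    (subst (AllAllowed (ops ++ after)) (sym (current-step op D)) allowed)
    (subst (λ A → All (Admissible P) (history (ops ++ after) A)) (sym (current-step op D)) adm)

-- Cost of an operation

module OperationCost (SD : Dictionary) (t : Overhead) (k : ℕ) .{{_ : NonZero k}} where

  private module SD = Dictionary SD
  open Overhead t
  open Binning SD t k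
  open Structure
  open Correctness SD t k

  bin-size-≤n : ∀ {P D} → Invariant P D → ∀ i → length (bin D i) ≤ length (current D)
  bin-size-≤n {D = D} inv i = increasing-⊆-length (SD.contents-increasing (lookup (bins D) i))
    (Invariant.current-increasing inv) (proj₁ ∘ Invariant.bin⁻ inv)

  -- `occupancy` with D = κ N and R = N, which explains the exponent 4 = 3 + 1. The 1 in the
  -- coefficient pays for the predecessor on the bin's length, as N ≥ 1.
  bin-size-polynomial : ∀ {P D} κ N → Invariant P D → Admissible P (current D) →
    let n = length (current D) in k ≤ κ * n → fromℕ n ÷₀ fromℕ k ℚ.* P ℚ.≤ fromℕ N →
    ∀ i → length (bin D i) ≤ (1 + 20 * κ ^ 3) * N ^ 4
  bin-size-polynomial {P} {D} κ N inv (2≤n , ratio≤P) k≤κn qP≤N i = begin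
    length (bin D i)                           ≤⟨ n≤suc-pred (length (bin D i)) ⟩
    suc (ℕ.pred (length (bin D i)))            ≤⟨ s≤s pred-size ⟩
    1 + 20 * (κ * N) ^ 3 * N                   ≤⟨ ℕ.+-monoˡ-≤ (20 * (κ * N) ^ 3 * N) (ℕ.^-monoˡ-≤ 4 1≤N) ⟩
    N ^ 4 + 20 * (κ * N) ^ 3 * N               ≡⟨ shape κ N ⟩
    (1 + 20 * κ ^ 3) * N ^ 4                   ∎
    where
    open ℕ.≤-Reasoning
    open Invariant inv

    n≤suc-pred : ∀ n → n ≤ suc (ℕ.pred n)
    n≤suc-pred zero    = z≤n
    n≤suc-pred (suc n) = ℕ.≤-refl

    shape : ∀ κ N → N * (N * (N * (N * 1))) + 20 * (κ * N * (κ * N * (κ * N * 1))) * N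
                  ≡ (1 + 20 * (κ * (κ * (κ * 1)))) * (N * (N * (N * (N * 1))))
    shape = solve-∀

    1≤P : 1ℚ ℚ.≤ P
    1≤P = ℚ.≤-trans (1≤gapRatio current-increasing 2≤n) ratio≤P

    bounds : (length (current D) ≤ N * k) × (P ℚ.≤ fromℕ (κ * N))
    bounds = factor-bounds κ N k≤κn 1≤P qP≤N

    1≤N : 1 ≤ N
    1≤N = positive-factor N (ℕ.≤-trans 2≤n (proj₁ bounds))
      where
      positive-factor : ∀ N → 2 ≤ N * k → 1 ≤ N
      positive-factor (suc _) _ = s≤s z≤n

    1≤κN : 1 ≤ κ * N
    1≤κN = fromℕ-cancel-≤ (ℚ.≤-trans 1≤P (proj₂ bounds))

    Δ̂≤2κN : Δ̂ D ℚ.≤ fromℕ (2 * (κ * N))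
    Δ̂≤2κN = ℚ.≤-trans Δ̂≤2P (subst (2ℚ ℚ.* P ℚ.≤_) (sym (fromℕ-* 2 (κ * N)))
      (ℚ.*-monoˡ-≤-nonNeg 2ℚ (proj₂ bounds)))

    bin-increasing : Increasing (bin D i)
    bin-increasing = SD.contents-increasing (lookup (bins D) i)

    pred-size : ℕ.pred (length (bin D i)) ≤ 20 * (κ * N) ^ 3 * N
    pred-size = occupancy (κ * N) N
      snapshot-increasing snapshot-gapped (ℚ.≤-trans snapshot-ratio (proj₂ bounds))
      current-increasing 2≤n (ℚ.≤-trans ratio≤P (proj₂ bounds))
      survivors-increasing survivors⊆snapshot survivors⊆current
      (survivors-bound {u = updates D} snapshot-gapped few-updates survivors-many)
      bin-increasing (proj₁ ∘ bin⁻)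
      (bin-span (κ * N) snapshot-increasing snapshot-gapped 0≤Δ̂ Δ̂≤2κN 1≤κN bin-increasing (proj₂ ∘ bin⁻))
      (proj₁ bounds)

  inBinCost-≤ : ∀ {B x cost} D → (∀ {i} → locate D x ≡ just i → cost (lookup (bins D) i) ≤ B) →
    inBinCost x cost D ≤ B
  inBinCost-≤ {x = x} D bound with locate D x
  ... | just i  = bound refl
  ... | nothing = z≤n

  operationCost-≤ : ∀ {P D f F} op (ops-in : OperationsIn f SD) → Invariant P D → Allowed op (current D) →
    (∀ i → f (length (bin D i)) ≤ F) → operationCost op D ≤ perOperation + proj₁ ops-in * F
  operationCost-≤ {D = D} {F = F} op (a , cost) inv ok f≤F = go op ok
    where
    open Invariant inv
    enlarge : ∀ {c i} → c ≤ a * _ → c ≤ a * F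
    enlarge {i = i} c≤ = ℕ.≤-trans c≤ (ℕ.*-monoʳ-≤ a (f≤F i))
    go : ∀ op → Allowed op (current D) → operationCost op D ≤ perOperation + a * F
    go (search x) _  = ℕ.+-monoʳ-≤ perOperation (inBinCost-≤ {cost = SD.searchCost x} D λ {i} _ →
      enlarge {i = i} (proj₁ (cost x (lookup (bins D) i))))
    go (insert x) x∉ = ℕ.+-monoʳ-≤ perOperation (inBinCost-≤ {cost = SD.insertCost x} D λ {i} _ →
      enlarge {i = i} (proj₁ (proj₂ (cost x (lookup (bins D) i))) (x∉ ∘ proj₁ ∘ bin⁻)))
    go (delete x) x∈ = ℕ.+-monoʳ-≤ perOperation (inBinCost-≤ {cost = SD.deleteCost x} D λ {i} eq →
      enlarge {i = i} (proj₂ (proj₂ (cost x (lookup (bins D) i))) (bin⁺ x∈ eq)))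

module _ {κ k ops A} (life : Lifetime κ k ops A) where
  open Lifetime life

  admissible : All (λ B → (2 ≤ length B) × (gapRatio B ℚ.≤ Δmax ops A)) (history ops A)
  admissible = All.zip (gapped , Δmax-upper ops A)

operation-bound : ∀ {f} SD t κ → Logarithmic f → OperationsIn f SD → OperationBound SD t κ f
operation-bound {f} SD t κ log ops-in@(a , _) = C , bound
  where
  open Overhead t
  open Logarithmic log
  growth = polynomial (1 + 20 * κ ^ 3) 4
  -- The successor makes `c` positive, so that the same constant serves when the minimum is `n` and
  -- the bin is bounded by the whole set.
  c = suc (proj₁ growth)
  C = perOperation + a * c
  bound : ∀ (k : ℕ) .{{_ : NonZero k}} (A : List ℤ) (before : List Op) (op : Op) (after : List Op) →
    let open Binning SD t k
        ops = before ++ op ∷ after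
        n   = length (applyAll before A)
    in Lifetime κ k ops A → operationCost op (run before (buildWith (gapRatio A) A))
         ≤ C * (f at (fromℕ n ℚ.⊓ (fromℕ n ÷₀ fromℕ k ℚ.* Δmax ops A)))
  bound k A before op after life = begin
    operationCost op D                       ≤⟨ operationCost-≤ {f = f} op ops-in inv (proj₁ allowed′) size-bound ⟩
    perOperation + a * (c * F)               ≤⟨ ℕ.+-monoˡ-≤ (a * (c * F)) (ℕ.m≤m*n perOperation F {{ℕ.>-nonZero (positive N)}}) ⟩
    perOperation * F + a * (c * F)           ≡⟨ cong (λ m → perOperation * F + m) (ℕ.*-assoc a c F) ⟨
    perOperation * F + a * c * F             ≡⟨ ℕ.*-distribʳ-+ F perOperation (a * c) ⟨
    C * F                                    ∎
    where
    open ℕ.≤-Reasoning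
    open Binning SD t k
    open Correctness SD t k
    open OperationCost SD t k
    open Lifetime life
    ops = before ++ op ∷ after
    P   = Δmax ops A
    n   = length (applyAll before A)
    r   = fromℕ n ÷₀ fromℕ k ℚ.* P
    N   = ℤ.∣ ceiling (fromℕ n ℚ.⊓ r) ∣
    F   = f N
    D₀  = buildWith (gapRatio A) A
    D   = run before D₀

    current≡ : Structure.current D ≡ applyAll before A
    current≡ = current-run before D₀

    A-admissible : Admissible P A
    A-admissible = history-head ops (admissible life)

    inv₀ : Invariant P D₀
    inv₀ = buildWith-invariant increasing A-admissible 0≤ratio
      (ℚ.≤-trans (proj₂ A-admissible) P≤2P)
      where
      0≤ratio : 0ℚ ℚ.≤ gapRatio A
      0≤ratio = ℚ.≤-trans (ℚ.nonNegative⁻¹ 1ℚ) (1≤gapRatio increasing (proj₁ A-admissible))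
      P≤2P : P ℚ.≤ 2ℚ ℚ.* P
      P≤2P = p≤2p (ℚ.≤-trans 0≤ratio (proj₂ A-admissible))

    ran = run-invariant before inv₀ allowed (admissible life)
    inv = proj₁ ran
    allowed′ = proj₁ (proj₂ ran)
    now : Admissible P (Structure.current D)
    now = history-head (op ∷ after) (proj₂ (proj₂ ran))

    k≤κn : k ≤ κ * n
    k≤κn = history-++-head before binsO[n]

    size-bound : ∀ i → f (length (bin D i)) ≤ c * F
    size-bound i with ℚ.≤-total (fromℕ n) r
    ... | inj₁ n≤r = ℕ.≤-trans (mono size≤N) (ℕ.m≤n*m F c)
      where
      size≤N : length (bin D i) ≤ N
      size≤N = ℕ.≤-trans (subst (λ B → length (bin D i) ≤ length B) current≡ (bin-size-≤n inv i))
        (fromℕ-cancel-≤ (subst (ℚ._≤ fromℕ N) (ℚ.p≤q⇒p⊓q≡p n≤r) (≤ceiling (fromℕ n ℚ.⊓ r))))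
    ... | inj₂ r≤n = ℕ.≤-trans (mono size≤) (ℕ.≤-trans (proj₂ growth N) (ℕ.*-monoˡ-≤ F (ℕ.n≤1+n (proj₁ growth))))
      where
      r≤N : r ℚ.≤ fromℕ N
      r≤N = subst (ℚ._≤ fromℕ N) (ℚ.p≥q⇒p⊓q≡q r≤n) (≤ceiling (fromℕ n ℚ.⊓ r))
      size≤ : length (bin D i) ≤ (1 + 20 * κ ^ 3) * N ^ 4
      size≤ = bin-size-polynomial κ N inv now
        (subst (λ B → k ≤ κ * length B) (sym current≡) k≤κn)
        (subst (λ B → fromℕ (length B) ÷₀ fromℕ k ℚ.* P ℚ.≤ fromℕ N) (sym current≡) r≤N) i

-- Cost of rebuilding

sum-tabulate-mono : ∀ {k} (g h : Fin k → ℕ) → (∀ i → g i ≤ h i) →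
  Vec.sum (tabulate g) ≤ Vec.sum (tabulate h)
sum-tabulate-mono {zero}  g h g≤h = z≤n
sum-tabulate-mono {suc k} g h g≤h =
  ℕ.+-mono-≤ (g≤h Fin.zero) (sum-tabulate-mono (g ∘ Fin.suc) (h ∘ Fin.suc) (g≤h ∘ Fin.suc))

sum-tabulate-bump : ∀ {k} (g h : Fin k → ℕ) j → (∀ i → i ≢ j → g i ≤ h i) → g j ≤ suc (h j) →
  Vec.sum (tabulate g) ≤ suc (Vec.sum (tabulate h))
sum-tabulate-bump g h Fin.zero g≤h bump =
  ℕ.+-mono-≤ bump (sum-tabulate-mono (g ∘ Fin.suc) (h ∘ Fin.suc) λ i → g≤h (Fin.suc i) λ ())
sum-tabulate-bump g h (Fin.suc j) g≤h bump = ℕ.≤-trans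
  (ℕ.+-mono-≤ (g≤h Fin.zero λ ()) (sum-tabulate-bump (g ∘ Fin.suc) (h ∘ Fin.suc) j
    (λ i i≢j → g≤h (Fin.suc i) (i≢j ∘ Fin.suc-injective)) bump))
  (ℕ.≤-reflexive (ℕ.+-suc (h Fin.zero) _))

sum-tabulate-affine : ∀ {k} a (g : Fin k → ℕ) →
  Vec.sum (tabulate (λ i → a * suc (g i))) ≡ a * (k + Vec.sum (tabulate g))
sum-tabulate-affine {zero}  a g = sym (ℕ.*-zeroʳ a)
sum-tabulate-affine {suc k} a g = trans
  (cong (a * suc (g Fin.zero) ℕ.+_) (sum-tabulate-affine a (g ∘ Fin.suc)))
  (shape a (g Fin.zero) k (Vec.sum (tabulate (g ∘ Fin.suc))))
  where
  shape : ∀ a x k s → a * (1 + x) + a * (k + s) ≡ a * (1 + k + (x + s))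
  shape = solve-∀

-- The fibres of a partial map are disjoint, so each element raises at most one summand, and none if
-- it is mapped to `nothing`.
sum-fibres : ∀ {A : Set} {k} (φ : A → Maybe (Fin k)) xs →
  Vec.sum (tabulate (λ i → length (filter (λ x → Maybe.≡-dec Fin._≟_ (φ x) (just i)) xs))) ≤ length xs
sum-fibres {k = k} φ [] = ℕ.≤-reflexive (zeros k)
  where
  zeros : ∀ k → Vec.sum (tabulate {n = k} (λ _ → 0)) ≡ 0
  zeros zero    = refl
  zeros (suc k) = zeros k
sum-fibres {A} {k} φ (x ∷ xs) = go (φ x) refl
  where
  fibre? : ∀ i (y : A) → Dec (φ y ≡ just i)
  fibre? i y = Maybe.≡-dec Fin._≟_ (φ y) (just i)
  count : List A → Fin k → ℕ
  count ys i = length (filter (fibre? i) ys)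
  outside : ∀ i → φ x ≢ just i → count (x ∷ xs) i ≤ count xs i
  outside i neq = ℕ.≤-reflexive (cong length (List.filter-reject (fibre? i) neq))
  go : ∀ m → φ x ≡ m → Vec.sum (tabulate (count (x ∷ xs))) ≤ suc (length xs)
  go nothing  eq = ℕ.m≤n⇒m≤1+n (ℕ.≤-trans
    (sum-tabulate-mono (count (x ∷ xs)) (count xs) (λ i → outside i λ eq′ → case trans (sym eq) eq′ of λ ()))
    (sum-fibres φ xs))
  go (just j) eq = ℕ.≤-trans
    (sum-tabulate-bump (count (x ∷ xs)) (count xs) j
      (λ i i≢j → outside i λ eq′ → i≢j (Maybe.just-injective (trans (sym eq′) eq)))
      (ℕ.≤-reflexive (cong length (List.filter-accept (fibre? j) eq))))
    (s≤s (sum-fibres φ xs))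

-- Updates and set sizes against the elements ever stored

updateCount : List Op → ℕ
updateCount []               = 0
updateCount (search x ∷ ops) = updateCount ops
updateCount (insert x ∷ ops) = suc (updateCount ops)
updateCount (delete x ∷ ops) = suc (updateCount ops)

-- `elementsEver ops []` is the number of insertions: the recursion carries `A` along unchanged, so
-- the initial elements split off.
elementsEver-length : ∀ ops A → elementsEver ops A ≡ length A + elementsEver ops []
elementsEver-length []               A = sym (ℕ.+-identityʳ (length A))
elementsEver-length (insert x ∷ ops) A = trans (cong suc (elementsEver-length ops A))
  (sym (ℕ.+-suc (length A) (elementsEver ops [])))
elementsEver-length (search x ∷ ops) A = elementsEver-length ops A
elementsEver-length (delete x ∷ ops) A = elementsEver-length ops A

elementsEver-add : ∀ ops x A → elementsEver ops (add x A) ≡ suc (elementsEver ops A)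
elementsEver-add ops x A = begin
  elementsEver ops (add x A)                 ≡⟨ elementsEver-length ops (add x A) ⟩
  length (add x A) + elementsEver ops []     ≡⟨ cong (λ l → l + elementsEver ops []) (length-add x A) ⟩
  suc (length A + elementsEver ops [])       ≡⟨ cong suc (elementsEver-length ops A) ⟨
  suc (elementsEver ops A)                   ∎
  where open ≡-Reasoning

elementsEver-remove : ∀ ops {x A} → x ∈ A → suc (elementsEver ops (remove x A)) ≤ elementsEver ops A
elementsEver-remove ops {x} {A} x∈A = begin
  suc (elementsEver ops (remove x A))             ≡⟨ cong suc (elementsEver-length ops (remove x A)) ⟩
  suc (length (remove x A)) + elementsEver ops [] ≤⟨ ℕ.+-monoˡ-≤ (elementsEver ops []) (length-remove-∈ x∈A) ⟩
  length A + elementsEver ops []                  ≡⟨ elementsEver-length ops A ⟨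
  elementsEver ops A                              ∎
  where open ℕ.≤-Reasoning

length≤elementsEver : ∀ ops A → length A ≤ elementsEver ops A
length≤elementsEver ops A = ℕ.≤-trans (ℕ.m≤m+n (length A) (elementsEver ops []))
  (ℕ.≤-reflexive (sym (elementsEver-length ops A)))

-- The elements present plus the insertions still to come never increase along the sequence, and
-- they dominate the current size.
history-sizes : ∀ {M} ops A → AllAllowed ops A → elementsEver ops A ≤ M →
  All (λ B → length B ≤ M) (history ops A)
history-sizes []         A _            ever≤M = ever≤M ∷ []
history-sizes (op ∷ ops) A (ok , allowed) ever≤M =
  ℕ.≤-trans (length≤elementsEver (op ∷ ops) A) ever≤M
  ∷ history-sizes ops (apply op A) allowed (ℕ.≤-trans (ever-step op ok) ever≤M)
  where
  ever-step : ∀ op → Allowed op A → elementsEver ops (apply op A) ≤ elementsEver (op ∷ ops) A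
  ever-step (search x) _   = ℕ.≤-refl
  ever-step (insert x) _   = ℕ.≤-reflexive (elementsEver-add ops x A)
  ever-step (delete x) x∈A = ℕ.≤-trans (ℕ.n≤1+n _) (elementsEver-remove ops x∈A)

-- Every initial element pays for its deletion, every insertion for itself and for one later
-- deletion.
updateCount-≤ : ∀ ops A → AllAllowed ops A → updateCount ops ≤ length A + 2 * elementsEver ops []
updateCount-≤ []               A _             = z≤n
updateCount-≤ (search x ∷ ops) A (_ , allowed) = updateCount-≤ ops A allowed
updateCount-≤ (insert x ∷ ops) A (_ , allowed) = begin
  suc (updateCount ops)                               ≤⟨ s≤s (updateCount-≤ ops (add x A) allowed) ⟩
  suc (length (add x A) + 2 * elementsEver ops [])    ≡⟨ cong (λ l → suc (l + 2 * elementsEver ops [])) (length-add x A) ⟩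
  suc (suc (length A) + 2 * elementsEver ops [])      ≡⟨ shape (length A) (elementsEver ops []) ⟩
  length A + 2 * suc (elementsEver ops [])            ∎
  where
  open ℕ.≤-Reasoning
  shape : ∀ a e → 1 + (1 + a + 2 * e) ≡ a + 2 * (1 + e)
  shape = solve-∀
updateCount-≤ (delete x ∷ ops) A (x∈A , allowed) = ℕ.≤-trans
  (s≤s (updateCount-≤ ops (remove x A) allowed))
  (ℕ.+-monoˡ-≤ (2 * elementsEver ops []) (length-remove-∈ x∈A))

updateCount-≤-elementsEver : ∀ ops A → AllAllowed ops A → updateCount ops ≤ 2 * elementsEver ops A
updateCount-≤-elementsEver ops A allowed = begin
  updateCount ops                          ≤⟨ updateCount-≤ ops A allowed ⟩
  length A + 2 * elementsEver ops []       ≤⟨ ℕ.+-monoˡ-≤ (2 * elementsEver ops []) (ℕ.m≤n*m (length A) 2) ⟩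
  2 * length A + 2 * elementsEver ops []   ≡⟨ ℕ.*-distribˡ-+ 2 (length A) (elementsEver ops []) ⟨
  2 * (length A + elementsEver ops [])     ≡⟨ cong (2 *_) (elementsEver-length ops A) ⟨
  2 * elementsEver ops A                   ∎
  where open ℕ.≤-Reasoning

-- The cost of a rebuild per element. The pointers, and the constant that each of the `k` builds
-- costs even on an empty bin, are charged to the elements through k ≤ κ n.
rebuildUnit : ∀ SD → LinearBuild SD → Overhead → ℕ → ℕ
rebuildUnit SD (a , _) t κ = perElement + (perBin + a) * κ + a
  where open Overhead t

module RebuildCost (SD : Dictionary) (linear : LinearBuild SD) (t : Overhead) (κ k : ℕ) .{{_ : NonZero k}} where

  private module SD = Dictionary SD
  open Overhead t
  open Binning SD t k
  open Structure hiding (locate)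
  open Correctness SD t k

  private
    a = proj₁ linear
    unit = rebuildUnit SD linear t κ

  buildWithCost-≤ : ∀ {Δ̂ A} → Increasing A → k ≤ κ * length A → buildWithCost Δ̂ A ≤ unit * length A
  buildWithCost-≤ {Δ̂} {A} inc k≤κn = begin
    pe * n + pb * k + Vec.sum (tabulate (λ i → SD.buildCost (binElements i)))
      ≤⟨ ℕ.+-monoʳ-≤ (pe * n + pb * k) builds ⟩
    pe * n + pb * k + a * (k + n)
      ≡⟨ collect pe pb a n k ⟩
    pe * n + (pb + a) * k + a * n
      ≤⟨ ℕ.+-monoˡ-≤ (a * n) (ℕ.+-monoʳ-≤ (pe * n) (ℕ.*-monoʳ-≤ (pb + a) k≤κn)) ⟩
    pe * n + (pb + a) * (κ * n) + a * n
      ≡⟨ factor pe pb a n κ ⟩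
    unit * n
      ∎
    where
    open ℕ.≤-Reasoning
    open Subdivision k Δ̂ A
    n = length A
    pe = perElement
    pb = perBin
    collect : ∀ pe pb a n k → pe * n + pb * k + a * (k + n) ≡ pe * n + (pb + a) * k + a * n
    collect = solve-∀
    factor : ∀ pe pb a n κ → pe * n + (pb + a) * (κ * n) + a * n ≡ (pe + (pb + a) * κ + a) * n
    factor = solve-∀
    builds : Vec.sum (tabulate (λ i → SD.buildCost (binElements i))) ≤ a * (k + n)
    builds = begin
      Vec.sum (tabulate (λ i → SD.buildCost (binElements i)))
        ≤⟨ sum-tabulate-mono _ (λ i → a * suc (length (binElements i))) (λ i → proj₂ linear
             (Linked.filter⁺ (λ x → Maybe.≡-dec Fin._≟_ (locate x) (just i)) ℤ.<-trans inc)) ⟩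
      Vec.sum (tabulate (λ i → a * suc (length (binElements i))))
        ≡⟨ sum-tabulate-affine a (λ i → length (binElements i)) ⟩
      a * (k + Vec.sum (tabulate (λ i → length (binElements i))))
        ≤⟨ ℕ.*-monoʳ-≤ a (ℕ.+-monoʳ-≤ k (sum-fibres locate A)) ⟩
      a * (k + n)
        ∎

  -- Amortised accounting: each rebuild caused by the gap ratio halves P / Δ̂, so
  -- it decreases the exponent j, and each one caused by updates is paid by them.
  module Accounting (P : ℚ) (M : ℕ) where

    Bounded : List ℤ → Set
    Bounded B = (gapRatio B ℚ.≤ P) × (k ≤ κ * length B) × (length B ≤ M)

    -- The exponent `j` is the number of doublings after which the estimate is certain to have
    -- reached `P`.
    record Account (j : ℕ) (D : Structure) : Set where
      field
        current-increasing : Increasing (current D)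
        current-size       : length (current D) ≤ length (snapshot D) + updates D
        ratio-slack        : P ℚ.≤ fromℕ (2 ^ j) ℚ.* Δ̂ D

    -- The first summand prepays `j` rebuilds of sets of size up to `M`. The 3 is the ratio of
    -- elements to updates at a rebuild due to updates: the snapshot has at most 2 u elements and u
    -- updates add at most u more.
    credit : ℕ → Structure → ℕ
    credit j D = j * (unit * M) + 3 * unit * updates D

    maintain-account : ∀ {j D} → Account j D → Bounded (current D) →
      ∃[ j′ ] Account j′ (maintain D) × (maintainCost D + credit j′ (maintain D) ≤ credit j D)
    maintain-account {j} {D} acc (ratio≤P , k≤κn , n≤M) with rebuildDue D | due D
    ... | _ | not-due _ = j , acc , ℕ.≤-refl
    ... | _ | many-updates m≤2u = j
        , record { current-increasing = current-increasing ; current-size = ℕ.m≤m+n _ 0 ; ratio-slack = ratio-slack }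
        , (begin
          buildWithCost (Δ̂ D) (current D) + (j * (unit * M) + 3 * unit * 0)
            ≤⟨ ℕ.+-monoˡ-≤ _ (buildWithCost-≤ current-increasing k≤κn) ⟩
          unit * length (current D) + (j * (unit * M) + 3 * unit * 0)
            ≤⟨ ℕ.+-monoˡ-≤ _ (ℕ.*-monoʳ-≤ unit (ℕ.≤-trans current-size (ℕ.+-monoˡ-≤ u m≤2u))) ⟩
          unit * (2 * u + u) + (j * (unit * M) + 3 * unit * 0)
            ≡⟨ shape unit u (j * (unit * M)) ⟩
          j * (unit * M) + 3 * unit * u
            ∎)
      where
      open ℕ.≤-Reasoning
      open Account acc
      u = updates D
      shape : ∀ c u x → c * (2 * u + u) + (x + 3 * c * 0) ≡ x + 3 * c * u
      shape = solve-∀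
    ... | _ | ratio-exceeded Δ̂<ratio = exceeded j ratio-slack
      where
      open Account acc
      Δ̂′ = gapRatio (current D) ℚ.⊔ 2ℚ ℚ.* Δ̂ D
      D′ = buildWith Δ̂′ (current D)
      exceeded : ∀ j → P ℚ.≤ fromℕ (2 ^ j) ℚ.* Δ̂ D →
        ∃[ j′ ] Account j′ D′ × (buildWithCost Δ̂′ (current D) + credit j′ D′ ≤ credit j D)
      -- With exponent 0 the estimate is already at least `P`, so no attained ratio can exceed it.
      exceeded zero    slack = contradiction (ℚ.<-≤-trans Δ̂<ratio
        (ℚ.≤-trans ratio≤P (subst (P ℚ.≤_) (ℚ.*-identityˡ (Δ̂ D)) slack))) (ℚ.<-irrefl refl)
      exceeded (suc j) slack = j
        , record { current-increasing = current-increasing ; current-size = ℕ.m≤m+n _ 0 ; ratio-slack = slack′ }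
        , (begin
          buildWithCost Δ̂′ (current D) + (j * (unit * M) + 3 * unit * 0)
            ≤⟨ ℕ.+-monoˡ-≤ _ (ℕ.≤-trans (buildWithCost-≤ current-increasing k≤κn) (ℕ.*-monoʳ-≤ unit n≤M)) ⟩
          unit * M + (j * (unit * M) + 3 * unit * 0)
            ≡⟨ shape unit (unit * M) (j * (unit * M)) ⟩
          unit * M + j * (unit * M)
            ≤⟨ ℕ.m≤m+n _ (3 * unit * updates D) ⟩
          unit * M + j * (unit * M) + 3 * unit * updates D
            ∎)
        where
        open ℕ.≤-Reasoning
        shape : ∀ c y x → y + (x + 3 * c * 0) ≡ y + x
        shape = solve-∀
        slack′ : P ℚ.≤ fromℕ (2 ^ j) ℚ.* Δ̂′
        slack′ = ℚ.≤-trans slack (subst (ℚ._≤ fromℕ (2 ^ j) ℚ.* Δ̂′)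
          (trans (sym (ℚ.*-assoc (fromℕ (2 ^ j)) 2ℚ (Δ̂ D)))
            (cong (ℚ._* Δ̂ D) (trans (sym (fromℕ-* (2 ^ j) 2)) (cong fromℕ (ℕ.*-comm (2 ^ j) 2)))))
          (ℚ.*-monoˡ-≤-nonNeg (fromℕ (2 ^ j)) {{fromℕ-nonNeg (2 ^ j)}}
            (ℚ.p≤q⊔p (gapRatio (current D)) (2ℚ ℚ.* Δ̂ D))))

    insert-account : ∀ {j x D} → Account j D → x ∉ current D → Account j (perform (insert x) D)
    insert-account {j} {x} {D} acc x∉ = record
      { current-increasing = add-increasing (current D) x∉ current-increasing
      ; current-size       = ℕ.≤-trans (ℕ.≤-reflexive (length-add x (current D)))
          (ℕ.≤-trans (s≤s current-size) (ℕ.≤-reflexive (sym (ℕ.+-suc (length (snapshot D)) (updates D)))))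
      ; ratio-slack        = ratio-slack
      }
      where open Account acc

    delete-account : ∀ {j x D} → Account j D → x ∈ current D → Account j (perform (delete x) D)
    delete-account {j} {x} {D} acc x∈ = record
      { current-increasing = remove-increasing current-increasing
      ; current-size       = ℕ.≤-trans (ℕ.<⇒≤ (length-remove-∈ x∈))
          (ℕ.≤-trans current-size (ℕ.+-monoʳ-≤ (length (snapshot D)) (ℕ.n≤1+n (updates D))))
      ; ratio-slack        = ratio-slack
      }
      where open Account acc

    -- Future updates hold three units each in reserve; performing one moves its share into the
    -- credit of the structure, which then covers a possible rebuild.
    pay : ∀ {j D cost after} ops →
      cost + after ≤ j * (unit * M) + 3 * unit * suc (updates D) →
      cost + (after + 3 * unit * updateCount ops) ≤ credit j D + 3 * unit * suc (updateCount ops)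
    pay {j} {D} {cost} {after} ops paid = begin
      cost + (after + 3 * unit * updateCount ops)
        ≡⟨ ℕ.+-assoc cost after _ ⟨
      cost + after + 3 * unit * updateCount ops
        ≤⟨ ℕ.+-monoˡ-≤ _ paid ⟩
      j * (unit * M) + 3 * unit * suc (updates D) + 3 * unit * updateCount ops
        ≡⟨ shape (j * (unit * M)) unit (updates D) (updateCount ops) ⟩
      j * (unit * M) + 3 * unit * updates D + 3 * unit * suc (updateCount ops)
        ∎
      where
      open ℕ.≤-Reasoning
      shape : ∀ x c u v → x + 3 * c * (1 + u) + 3 * c * v ≡ x + 3 * c * u + 3 * c * (1 + v)
      shape = solve-∀

    step-account : ∀ {j D} op ops → Account j D → Allowed op (current D) → Bounded (apply op (current D)) →
      ∃[ j′ ] Account j′ (step op D) ×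
        (stepRebuildCost op D + (credit j′ (step op D) + 3 * unit * updateCount ops)
          ≤ credit j D + 3 * unit * updateCount (op ∷ ops))
    step-account {j} {D} (search x) ops acc _ _ = j , acc , ℕ.≤-refl
    step-account {j} {D} (insert x) ops acc x∉ bdd
      with j′ , acc′ , paid ← maintain-account (insert-account acc x∉) bdd =
      j′ , acc′ , pay {j} {D} {maintainCost (perform (insert x) D)} {credit j′ (step (insert x) D)} ops paid
    step-account {j} {D} (delete x) ops acc x∈ bdd
      with j′ , acc′ , paid ← maintain-account (delete-account acc x∈) bdd =
      j′ , acc′ , pay {j} {D} {maintainCost (perform (delete x) D)} {credit j′ (step (delete x) D)} ops paid

    runRebuildCost-≤ : ∀ {j D} ops → Account j D → AllAllowed ops (current D) →
      All Bounded (history ops (current D)) →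
      runRebuildCost ops D ≤ credit j D + 3 * unit * updateCount ops
    runRebuildCost-≤ []             _   _              _         = z≤n
    runRebuildCost-≤ {j} {D} (op ∷ ops) acc (ok , allowed) (_ ∷ bdd)
      with j′ , acc′ , paid ← step-account op ops acc ok (history-head ops bdd) = ℕ.≤-trans
        (ℕ.+-monoʳ-≤ (stepRebuildCost op D) (runRebuildCost-≤ ops acc′
          (subst (AllAllowed ops) (sym (current-step op D)) allowed)
          (subst (λ A → All Bounded (history ops A)) (sym (current-step op D)) bdd)))
        paid

  -- The 7 is one for the initial build and six for the updates, three units each for at most twice
  -- as many updates as elements; `j` accounts for the doublings.
  totalRebuildCost-≤ : ∀ {P Δ̂₀ j ops A} → Lifetime κ k ops A → Δmax ops A ℚ.≤ P → P ℚ.≤ fromℕ (2 ^ j) ℚ.* Δ̂₀ →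
    totalRebuildCost Δ̂₀ ops A ≤ (7 + j) * unit * elementsEver ops A
  totalRebuildCost-≤ {P} {Δ̂₀} {j} {ops} {A} life Δmax≤P slack = begin
    buildWithCost Δ̂₀ A + runRebuildCost ops (buildWith Δ̂₀ A)
      ≤⟨ ℕ.+-mono-≤ (buildWithCost-≤ increasing (history-head ops binsO[n])) (runRebuildCost-≤ {j} ops account allowed bounded) ⟩
    unit * length A + (j * (unit * M) + 3 * unit * 0 + 3 * unit * updateCount ops)
      ≤⟨ ℕ.+-mono-≤ (ℕ.*-monoʳ-≤ unit (length≤elementsEver ops A))
           (ℕ.+-monoʳ-≤ (j * (unit * M) + 3 * unit * 0) (ℕ.*-monoʳ-≤ (3 * unit) (updateCount-≤-elementsEver ops A allowed))) ⟩
    unit * M + (j * (unit * M) + 3 * unit * 0 + 3 * unit * (2 * M))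
      ≡⟨ shape unit j M ⟩
    (7 + j) * unit * M
      ∎
    where
    open ℕ.≤-Reasoning
    open Lifetime life
    M = elementsEver ops A
    open Accounting P M
    shape : ∀ c j m → c * m + (j * (c * m) + 3 * c * 0 + 3 * c * (2 * m)) ≡ (7 + j) * c * m
    shape = solve-∀
    account : Account j (buildWith Δ̂₀ A)
    account = record { current-increasing = increasing ; current-size = ℕ.m≤m+n (length A) 0 ; ratio-slack = slack }
    bounded : All Bounded (history ops A)
    bounded = All.zip (All.map (λ r → ℚ.≤-trans r Δmax≤P) (Δmax-upper ops A)
                      , All.zip (binsO[n] , history-sizes ops A allowed ℕ.≤-refl))

-- Total rebuilding cost with unknown and with known gap ratio

amortized-bound : ∀ SD → LinearBuild SD → ∀ t κ → AmortizedRebuildBound SD t κ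
amortized-bound SD linear t κ = C , bound
  where
  unit : ℕ
  unit = rebuildUnit SD linear t κ
  c = suc (lg κ + 1)
  C = unit * (7 + c)
  bound : ∀ (k : ℕ) .{{_ : NonZero k}} (A : List ℤ) (ops : List Op) →
    let open Binning SD t k in Lifetime κ k ops A → ∀ {B} → B ∈ history ops A →
    let n = length B in
    totalRebuildCost (gapRatio A) ops A
      ≤ elementsEver ops A * (C * (lg at (fromℕ n ÷₀ fromℕ k ℚ.* Δmax ops A)))
  bound k A ops life {B} B∈ = begin
    totalRebuildCost (gapRatio A) ops A      ≤⟨ totalRebuildCost-≤ {fromℕ (κ * N)} {gapRatio A} {j} life (proj₂ bounds) slack ⟩
    (7 + j) * unit * M                       ≤⟨ ℕ.*-monoˡ-≤ M (ℕ.*-monoˡ-≤ unit 7+j≤) ⟩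
    (7 + c) * lg N * unit * M                ≡⟨ shape unit (7 + c) (lg N) M ⟩
    M * (C * lg N)                           ∎
    where
    open ℕ.≤-Reasoning
    open Binning SD t k
    open RebuildCost SD linear t κ k using (totalRebuildCost-≤)
    open Lifetime life
    M = elementsEver ops A
    r = fromℕ (length B) ÷₀ fromℕ k ℚ.* Δmax ops A
    N = ℤ.∣ ceiling r ∣
    -- Enough doublings for any start: the initial estimate is a gap ratio, hence at least 1, while
    -- Δ is at most κ N < 2 ^ j. This bound on Δ can be read off from any set `B` of the history.
    j = lg (κ * N)

    shape : ∀ u x l m → x * l * u * m ≡ m * (u * x * l)
    shape = solve-∀

    1≤ratio : 1ℚ ℚ.≤ gapRatio A
    1≤ratio = 1≤gapRatio increasing (history-head ops gapped)

    bounds = factor-bounds κ N {P = Δmax ops A} (All.lookup binsO[n] B∈)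
      (ℚ.≤-trans 1≤ratio (history-head ops (Δmax-upper ops A))) (≤ceiling r)

    slack : fromℕ (κ * N) ℚ.≤ fromℕ (2 ^ j) ℚ.* gapRatio A
    slack = ℚ.≤-trans (fromℕ-mono-≤ (ℕ.<⇒≤ (n<2^lg (κ * N))))
      (subst (ℚ._≤ fromℕ (2 ^ j) ℚ.* gapRatio A) (ℚ.*-identityʳ (fromℕ (2 ^ j)))
        (ℚ.*-monoˡ-≤-nonNeg (fromℕ (2 ^ j)) {{fromℕ-nonNeg (2 ^ j)}} 1≤ratio))

    7+j≤ : 7 + j ≤ (7 + c) * lg N
    7+j≤ = begin
      7 + lg (κ * N)             ≡⟨ cong (λ m → 7 + lg (κ * m)) (ℕ.^-identityʳ N) ⟨
      7 + lg (κ * N ^ 1)         ≤⟨ ℕ.+-mono-≤ (ℕ.m≤m*n 7 (lg N)) (lg-polynomial κ 1 N) ⟩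
      7 * lg N + c * lg N        ≡⟨ ℕ.*-distribʳ-+ (lg N) 7 c ⟨
      (7 + c) * lg N             ∎

-- Starting at Δ the exponent is 0, and no doubling has to be paid for.
known-ratio-bound : ∀ SD → LinearBuild SD → ∀ t κ → KnownRatioRebuildBound SD t κ
known-ratio-bound SD linear t κ = 7 * rebuildUnit SD linear t κ , λ k A ops life →
  RebuildCost.totalRebuildCost-≤ SD linear t κ k {Δmax ops A} {Δmax ops A} {0} life ℚ.≤-refl
    (ℚ.≤-reflexive (sym (ℚ.*-identityˡ (Δmax ops A))))

theorem4 : (SD : Dictionary) → LinearBuild SD → (t : Overhead) (κ : ℕ) →
    (OperationsIn lg SD →
    OperationBound SD t κ lg × AmortizedRebuildBound SD t κ × KnownRatioRebuildBound SD t κ)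
    × (OperationsIn lglg SD → OperationBound SD t κ lglg)
theorem4 SD linear t κ =
    (λ ops-in → operation-bound SD t κ lg-logarithmic ops-in
              , amortized-bound SD linear t κ
              , known-ratio-bound SD linear t κ)
  , operation-bound SD t κ lglg-logarithmic
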